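{- Let $X \subseteq \mathbb{Z}^d$ be a finite lattice-convex set of dimension $\dim(X) \geq 4$. Then \[ \operatorname{rc}(X) > \log_2 (\dim(X)) - \log_2 \log_2 (\dim(X)). \]
   Context: A set $X \subseteq \mathbb{Z}^d$ is lattice-convex if $\operatorname{conv}(X) \cap \mathbb{Z}^d = X$. The dimension $\dim(X)$ is the dimension of the affine hull of $X$. We say $X$ is described by $k$ linear inequalities within $\mathbb{Z}^d$ if $X = \{x \in \mathbb{Z}^d : Ax \le b,\ Ux = v\}$ for some real matrices $A, U$ and real vectors $b, v$, where $Ax \le b$ consists of $k$ inequalities (the number of equations $Ux=v$ is arbitrary and not counted). The relaxation complexity $\operatorname{rc}(X)$ is the minimal $k$ such that $X$ can be described by $k$ linear inequalities within $\mathbb{Z}^d$. -}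

module Defs where

open import Algebra.Bundles.Raw using (RawMonoid)
open import Data.Fin.Base using (Fin)
open import Data.Integer.Base as ℤ using (ℤ; +_)
import Data.Integer.Properties as ℤ
open import Data.Integer.Tactic.RingSolver using () renaming (solve-∀ to ℤ-solve-∀)
open import Data.List.Base using (List)
open import Data.List.Membership.Propositional using () renaming (_∈_ to _∈ₗ_)
open import Data.Nat.Base as ℕ using (ℕ; zero; suc; z≤n; s≤s; ⌊_/2⌋)
import Data.Nat.Coprimality as Coprime
open import Data.Nat.Logarithm using
  ( ⌊log₂_⌋; ⌊log₂⌋-mono-≤; ⌊log₂⌊n/2⌋⌋≡⌊log₂n⌋∸1; ⌊log₂[2^n]⌋≡n )
open import Data.Nat.Properties as ℕ using (^-*-assoc; ^-distribˡ-+-*)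
open import Data.Nat.Tactic.RingSolver using () renaming (solve-∀ to ℕ-solve-∀)
open import Data.Product.Base using (∃-syntax; Σ-syntax; _×_; _,_; proj₁; proj₂)
open import Data.Rational.Base as ℚ using (ℚ; mkℚ; 0ℚ; 1ℚ; ½; ∣_∣; ↥_; ↧ₙ_; _/_; toℚᵘ; *<*)
import Data.Rational.Properties as ℚ
open import Data.Rational.Solver using (module +-*-Solver)
open import Data.Rational.Unnormalised.Base as ℚᵘ using (mkℚᵘ)
import Data.Rational.Unnormalised.Properties as ℚᵘ
open import Data.Sum.Base using (inj₁; inj₂)
open import Data.Vec.Base using (Vec; lookup)
open import Data.Vec.Functional using (Vector)
open import Level using (0ℓ)
open import Relation.Binary.PropositionalEquality
  using (_≡_; refl; sym; trans; cong; cong₂; subst; subst₂)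
open import Relation.Nullary using (contradiction; yes; no)
open import Relation.Unary using (Pred; _∈_; _≐_)

∣p-q∣-comm : ∀ p q → ∣ p ℚ.- q ∣ ≡ ∣ q ℚ.- p ∣
∣p-q∣-comm p q = trans (sym (ℚ.∣-p∣≡∣p∣ (p ℚ.- q))) (cong ∣_∣ (lem p q))
  where
  open +-*-Solver
  lem : ∀ p q → ℚ.- (p ℚ.- q) ≡ q ℚ.- p
  lem = solve 2 (λ p q → :- (p :- q) := q :- p) refl

triangle : ∀ p q {r} → r ≡ p ℚ.+ q → ∣ r ∣ ℚ.≤ ∣ p ∣ ℚ.+ ∣ q ∣
triangle p q refl = ℚ.∣p+q∣≤∣p∣+∣q∣ p q

p≤∣p∣ : ∀ p → p ℚ.≤ ∣ p ∣
p≤∣p∣ p with ℚ.≤-total 0ℚ p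
... | inj₁ 0≤p = ℚ.≤-reflexive (sym (ℚ.0≤p⇒∣p∣≡p 0≤p))
... | inj₂ p≤0 = ℚ.≤-trans p≤0 (ℚ.0≤∣p∣ p)

p<q+ε⇒p-q<ε : ∀ {p q ε} → p ℚ.< q ℚ.+ ε → p ℚ.- q ℚ.< ε
p<q+ε⇒p-q<ε {p} {q} {ε} h = subst (p ℚ.- q ℚ.<_) (lem q ε) (ℚ.+-monoˡ-< (ℚ.- q) h)
  where
  open +-*-Solver
  lem : ∀ q ε → (q ℚ.+ ε) ℚ.- q ≡ ε
  lem = solve 2 (λ q ε → (q :+ ε) :- q := ε) refl

p-q<ε⇒p<q+ε : ∀ {p q ε} → p ℚ.- q ℚ.< ε → p ℚ.< q ℚ.+ ε
p-q<ε⇒p<q+ε {p} {q} {ε} h = subst (ℚ._< q ℚ.+ ε) (lem p q) (ℚ.+-monoʳ-< q h)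
  where
  open +-*-Solver
  lem : ∀ p q → q ℚ.+ (p ℚ.- q) ≡ p
  lem = solve 2 (λ p q → q :+ (p :- q) := p) refl

∣p-q∣<ε⇒p<q+ε : ∀ {p q ε} → ∣ p ℚ.- q ∣ ℚ.< ε → p ℚ.< q ℚ.+ ε
∣p-q∣<ε⇒p<q+ε {p} {q} h = p-q<ε⇒p<q+ε (ℚ.≤-<-trans (p≤∣p∣ (p ℚ.- q)) h)

close : ∀ {p q ε} → p ℚ.< q ℚ.+ ε → q ℚ.< p ℚ.+ ε → ∣ p ℚ.- q ∣ ℚ.< ε
close {p} {q} h₁ h₂ with ℚ.∣p∣≡p∨∣p∣≡-p (p ℚ.- q)
... | inj₁ eq = subst (ℚ._< _) (sym eq) (p<q+ε⇒p-q<ε h₁)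
... | inj₂ eq = subst (ℚ._< _) (sym (trans eq (lem p q))) (p<q+ε⇒p-q<ε h₂)
  where
  open +-*-Solver
  lem : ∀ p q → ℚ.- (p ℚ.- q) ≡ q ℚ.- p
  lem = solve 2 (λ p q → :- (p :- q) := q :- p) refl

0<½*ε : ∀ {ε} → 0ℚ ℚ.< ε → 0ℚ ℚ.< ½ ℚ.* ε
0<½*ε {ε} 0<ε = subst (ℚ._< ½ ℚ.* ε) (ℚ.*-zeroʳ ½) (ℚ.*-monoʳ-<-pos ½ 0<ε)

halves : ∀ ε → ½ ℚ.* ε ℚ.+ ½ ℚ.* ε ≡ ε
halves ε = trans (sym (ℚ.*-distribʳ-+ ε ½ ½)) (ℚ.*-identityˡ ε)

quotient : ∀ {ε B} → 0ℚ ℚ.< ε → 0ℚ ℚ.< B → ∃[ δ ] (0ℚ ℚ.< δ × B ℚ.* δ ≡ ε)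
quotient {ε} {B} 0<ε 0<B =
  ε ℚ.* (ℚ.1/ B) ,
  ℚ.positive⁻¹ (ε ℚ.* (ℚ.1/ B)) {{ℚ.pos*pos⇒pos ε (ℚ.1/ B) {{ℚ.1/pos⇒pos B}}}} ,
  trans (ℚ.*-comm B _) (trans (ℚ.*-assoc ε (ℚ.1/ B) B)
    (trans (cong (ε ℚ.*_) (ℚ.*-inverseˡ B)) (ℚ.*-identityʳ ε)))
  where instance
    _ = ℚ.positive 0<ε
    _ = ℚ.positive 0<B
    _ = ℚ.pos⇒nonZero B {{ℚ.positive 0<B}}

infix  8 -_
infixl 7 _*_
infixl 6 _+_ _-_
infix  4 _≈_ _≤_ _<_

record ℝ : Set where
  constructor mkℝ
  field
    seq    : ℕ → ℚ
    cauchy : ∀ ε → 0ℚ ℚ.< ε →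
             ∃[ N ] ∀ m n → N ℕ.≤ m → N ℕ.≤ n → ∣ seq m ℚ.- seq n ∣ ℚ.< ε

open ℝ public

_≈_ : ℝ → ℝ → Set
x ≈ y = ∀ ε → 0ℚ ℚ.< ε → ∃[ N ] ∀ n → N ℕ.≤ n → ∣ seq x n ℚ.- seq y n ∣ ℚ.< ε

_≤_ : ℝ → ℝ → Set
x ≤ y = ∀ ε → 0ℚ ℚ.< ε → ∃[ N ] ∀ n → N ℕ.≤ n → seq x n ℚ.< seq y n ℚ.+ ε

_<_ : ℝ → ℝ → Set
x < y = ∃[ ε ] (0ℚ ℚ.< ε × ∃[ N ] ∀ n → N ℕ.≤ n → seq x n ℚ.+ ε ℚ.≤ seq y n)

fromℚ : ℚ → ℝ
fromℚ p = mkℝ (λ _ → p) λ ε 0<ε → 0 , λ _ _ _ _ →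
  subst (λ q → ∣ q ∣ ℚ.< ε) (sym (ℚ.+-inverseʳ p)) 0<ε

fromℤ : ℤ → ℝ
fromℤ i = fromℚ (i / 1)

fromℕ : ℕ → ℝ
fromℕ n = fromℤ (+ n)

0ℝ 1ℝ : ℝ
0ℝ = fromℕ 0
1ℝ = fromℕ 1

_+_ : ℝ → ℝ → ℝ
x + y = mkℝ (λ n → seq x n ℚ.+ seq y n) λ ε 0<ε →
  let M , hx = cauchy x (½ ℚ.* ε) (0<½*ε 0<ε)
      N , hy = cauchy y (½ ℚ.* ε) (0<½*ε 0<ε)
  in M ℕ.⊔ N , λ m n M⊔N≤m M⊔N≤n →
     subst₂ ℚ._<_ refl (halves ε)
       (ℚ.≤-<-trans
         (triangle (seq x m ℚ.- seq x n) (seq y m ℚ.- seq y n)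
           (lem (seq x m) (seq x n) (seq y m) (seq y n)))
         (ℚ.+-mono-<
           (hx m n (ℕ.m⊔n≤o⇒m≤o M N M⊔N≤m) (ℕ.m⊔n≤o⇒m≤o M N M⊔N≤n))
           (hy m n (ℕ.m⊔n≤o⇒n≤o M N M⊔N≤m) (ℕ.m⊔n≤o⇒n≤o M N M⊔N≤n))))
  where
  open +-*-Solver
  lem : ∀ a b c d → (a ℚ.+ c) ℚ.- (b ℚ.+ d) ≡ (a ℚ.- b) ℚ.+ (c ℚ.- d)
  lem = solve 4 (λ a b c d → (a :+ c) :- (b :+ d) := (a :- b) :+ (c :- d)) refl

-_ : ℝ → ℝ
- x = mkℝ (λ n → ℚ.- seq x n) λ ε 0<ε →
  let N , h = cauchy x ε 0<ε
  in N , λ m n N≤m N≤n →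
     subst (λ p → ∣ p ∣ ℚ.< ε) (lem (seq x m) (seq x n)) (h n m N≤n N≤m)
  where
  open +-*-Solver
  lem : ∀ a b → b ℚ.- a ≡ (ℚ.- a) ℚ.- (ℚ.- b)
  lem = solve 2 (λ a b → b :- a := (:- a) :- (:- b)) refl

_-_ : ℝ → ℝ → ℝ
x - y = x + (- y)

bounded : ∀ x → ∃[ B ] (0ℚ ℚ.< B × ∃[ N ] ∀ n → N ℕ.≤ n → ∣ seq x n ∣ ℚ.≤ B)
bounded x with cauchy x 1ℚ (ℚ.positive⁻¹ 1ℚ)
... | N , h = ∣ seq x N ∣ ℚ.+ 1ℚ , pos , N , λ n N≤n →
  ℚ.≤-trans
    (triangle (seq x N) (seq x n ℚ.- seq x N) (lem (seq x N) (seq x n)))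
    (ℚ.+-monoʳ-≤ ∣ seq x N ∣ (ℚ.<⇒≤ (h n N N≤n ℕ.≤-refl)))
  where
  open +-*-Solver
  lem : ∀ a b → b ≡ a ℚ.+ (b ℚ.- a)
  lem = solve 2 (λ a b → b := a :+ (b :- a)) refl
  pos : 0ℚ ℚ.< ∣ seq x N ∣ ℚ.+ 1ℚ
  pos = ℚ.+-mono-≤-< (ℚ.0≤∣p∣ (seq x N)) (ℚ.positive⁻¹ 1ℚ)

∣pq∣<ε : ∀ {p q B δ ε} → 0ℚ ℚ.< B → B ℚ.* δ ≡ ε → ∣ p ∣ ℚ.≤ B → ∣ q ∣ ℚ.< δ →
         ∣ p ℚ.* q ∣ ℚ.< ε
∣pq∣<ε {p} {q} {B} {δ} {ε} 0<B Bδ≡ε p≤B q<δ =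
  subst₂ ℚ._<_ (sym (ℚ.∣p*q∣≡∣p∣*∣q∣ p q)) Bδ≡ε
    (ℚ.≤-<-trans
      (ℚ.*-monoʳ-≤-nonNeg ∣ q ∣ {{ℚ.nonNegative (ℚ.0≤∣p∣ q)}} p≤B)
      (ℚ.*-monoʳ-<-pos B {{ℚ.positive 0<B}} q<δ))

_*_ : ℝ → ℝ → ℝ
x * y = mkℝ (λ n → seq x n ℚ.* seq y n) λ ε 0<ε →
  let Bx , 0<Bx , Nx , hx = bounded x
      By , 0<By , Ny , hy = bounded y
      δx , 0<δx , eqx = quotient (0<½*ε 0<ε) 0<By
      δy , 0<δy , eqy = quotient (0<½*ε 0<ε) 0<Bx
      Mx , kx = cauchy x δx 0<δx
      My , ky = cauchy y δy 0<δy
      L = Nx ℕ.⊔ Mx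
      R = Ny ℕ.⊔ My
      toL : ∀ {n} → L ℕ.⊔ R ℕ.≤ n → L ℕ.≤ n
      toL = ℕ.m⊔n≤o⇒m≤o L R
      toR : ∀ {n} → L ℕ.⊔ R ℕ.≤ n → R ℕ.≤ n
      toR = ℕ.m⊔n≤o⇒n≤o L R
  in L ℕ.⊔ R , λ m n ≤m ≤n →
     subst₂ ℚ._<_ refl (halves ε)
       (ℚ.≤-<-trans
         (triangle (seq x m ℚ.* (seq y m ℚ.- seq y n)) (seq y n ℚ.* (seq x m ℚ.- seq x n))
           (lem (seq x m) (seq x n) (seq y m) (seq y n)))
         (ℚ.+-mono-<
           (∣pq∣<ε 0<Bx eqy (hx m (ℕ.m⊔n≤o⇒m≤o Nx Mx (toL ≤m)))
             (ky m n (ℕ.m⊔n≤o⇒n≤o Ny My (toR ≤m)) (ℕ.m⊔n≤o⇒n≤o Ny My (toR ≤n))))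
           (∣pq∣<ε 0<By eqx (hy n (ℕ.m⊔n≤o⇒m≤o Ny My (toR ≤n)))
             (kx m n (ℕ.m⊔n≤o⇒n≤o Nx Mx (toL ≤m)) (ℕ.m⊔n≤o⇒n≤o Nx Mx (toL ≤n))))))
  where
  open +-*-Solver
  lem : ∀ a b c d → (a ℚ.* c) ℚ.- (b ℚ.* d) ≡ a ℚ.* (c ℚ.- d) ℚ.+ d ℚ.* (a ℚ.- b)
  lem = solve 4 (λ a b c d → (a :* c) :- (b :* d) := a :* (c :- d) :+ d :* (a :- b)) refl

2^⌊log₂⌋≤ : ∀ n .{{_ : ℕ.NonZero n}} → 2 ℕ.^ ⌊log₂ n ⌋ ℕ.≤ n
2^⌊log₂⌋≤ n = go _ n refl
  where
  go : ∀ L n .{{_ : ℕ.NonZero n}} → ⌊log₂ n ⌋ ≡ L → 2 ℕ.^ L ℕ.≤ n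
  go zero    n@(suc _)         _  = s≤s z≤n
  go (suc L) n@(suc (suc k)) eq = ℕ.≤-trans
    (ℕ.*-monoʳ-≤ 2 (go L ⌊ n /2⌋ (trans (⌊log₂⌊n/2⌋⌋≡⌊log₂n⌋∸1 n) (cong ℕ.pred eq))))
    (ℕ.≤-trans
      (ℕ.≤-reflexive (cong (⌊ n /2⌋ ℕ.+_) (ℕ.+-identityʳ ⌊ n /2⌋)))
      (ℕ.≤-trans (ℕ.+-monoʳ-≤ ⌊ n /2⌋ (ℕ.⌊n/2⌋≤⌈n/2⌉ n))
        (ℕ.≤-reflexive (ℕ.⌊n/2⌋+⌈n/2⌉≡n n))))

≤2^1+⌊log₂⌋ : ∀ n → n ℕ.≤ 2 ℕ.^ suc ⌊log₂ n ⌋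
≤2^1+⌊log₂⌋ n with n ℕ.≤? 2 ℕ.^ suc ⌊log₂ n ⌋
... | yes p = p
... | no ¬p = contradiction
  (subst (ℕ._≤ ⌊log₂ n ⌋) (⌊log₂[2^n]⌋≡n (suc ⌊log₂ n ⌋)) (⌊log₂⌋-mono-≤ (ℕ.≰⇒≥ ¬p)))
  ℕ.1+n≰n

^-distribʳ-* : ∀ m n o → (m ℕ.* n) ℕ.^ o ≡ m ℕ.^ o ℕ.* n ℕ.^ o
^-distribʳ-* m n zero    = refl
^-distribʳ-* m n (suc o) =
  trans (cong ((m ℕ.* n) ℕ.*_) (^-distribʳ-* m n o)) (lem m n (m ℕ.^ o) (n ℕ.^ o))
  where
  lem : ∀ a b c d → a ℕ.* b ℕ.* (c ℕ.* d) ≡ a ℕ.* c ℕ.* (b ℕ.* d)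
  lem = ℕ-solve-∀

2^-cancel-≤ : ∀ {m n} → 2 ℕ.^ m ℕ.≤ 2 ℕ.^ n → m ℕ.≤ n
2^-cancel-≤ {m} {n} h with m ℕ.≤? n
... | yes p = p
... | no ¬p = contradiction (ℕ.≤-<-trans h (ℕ.^-monoʳ-< 2 (s≤s (s≤s z≤n)) (ℕ.≰⇒> ¬p))) (ℕ.<-irrefl refl)

[1+B]^j*c≤B^1+j : ∀ B j c → c ℕ.+ j ≡ B → suc B ℕ.^ j ℕ.* c ℕ.≤ B ℕ.^ suc j
[1+B]^j*c≤B^1+j B zero c eq =
  ℕ.≤-reflexive (trans (ℕ.*-identityˡ c) (trans (trans (sym (ℕ.+-identityʳ c)) eq) (sym (ℕ.*-identityʳ B))))
[1+B]^j*c≤B^1+j B (suc j) c eq = begin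
  suc B ℕ.* suc B ℕ.^ j ℕ.* c       ≡⟨ lem₁ B (suc B ℕ.^ j) c ⟩
  suc B ℕ.^ j ℕ.* (c ℕ.+ B ℕ.* c)   ≤⟨ ℕ.*-monoʳ-≤ (suc B ℕ.^ j) (ℕ.+-monoˡ-≤ (B ℕ.* c) (subst (c ℕ.≤_) eq (ℕ.m≤m+n c (suc j)))) ⟩
  suc B ℕ.^ j ℕ.* (B ℕ.+ B ℕ.* c)   ≡⟨ lem₂ B (suc B ℕ.^ j) c ⟩
  B ℕ.* (suc B ℕ.^ j ℕ.* suc c)     ≤⟨ ℕ.*-monoʳ-≤ B ([1+B]^j*c≤B^1+j B j (suc c) (trans (sym (ℕ.+-suc c j)) eq)) ⟩
  B ℕ.^ suc (suc j)                 ∎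
  where
  open ℕ.≤-Reasoning
  lem₁ : ∀ B x c → (1 ℕ.+ B) ℕ.* x ℕ.* c ≡ x ℕ.* (c ℕ.+ B ℕ.* c)
  lem₁ = ℕ-solve-∀
  lem₂ : ∀ B x c → x ℕ.* (B ℕ.+ B ℕ.* c) ≡ B ℕ.* (x ℕ.* (1 ℕ.+ c))
  lem₂ = ℕ-solve-∀

[1+2M]^M≤2[2M]^M : ∀ M .{{_ : ℕ.NonZero M}} →
  suc (2 ℕ.* M) ℕ.^ M ℕ.≤ 2 ℕ.* (2 ℕ.* M) ℕ.^ M
[1+2M]^M≤2[2M]^M M = ℕ.*-cancelʳ-≤ _ _ M (ℕ.≤-trans
  ([1+B]^j*c≤B^1+j (2 ℕ.* M) M M (cong (M ℕ.+_) (sym (ℕ.+-identityʳ M))))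
  (ℕ.≤-reflexive (lem M ((2 ℕ.* M) ℕ.^ M))))
  where
  lem : ∀ M x → 2 ℕ.* M ℕ.* x ≡ 2 ℕ.* x ℕ.* M
  lem = ℕ-solve-∀

module _ (M m m′ p q p′ q′ : ℕ)
         {{_ : ℕ.NonZero M}} {{_ : ℕ.NonZero p}} {{_ : ℕ.NonZero q}}
         {{_ : ℕ.NonZero p′}} {{_ : ℕ.NonZero q′}}
         (M≤m : M ℕ.≤ m) (M≤m′ : M ℕ.≤ m′)
         (h : p ℕ.* q′ ℕ.* (2 ℕ.* M) ℕ.≤ p′ ℕ.* q ℕ.* suc (2 ℕ.* M)) where

  private
    E a b a′ b′ : ℕ
    E = m ℕ.* m′ ℕ.* M
    a  = ⌊log₂ p ℕ.^ m ⌋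
    b  = ⌊log₂ q ℕ.^ m ⌋
    a′ = ⌊log₂ p′ ℕ.^ m′ ⌋
    b′ = ⌊log₂ q′ ℕ.^ m′ ⌋

    instance
      _ = ℕ.m*n≢0 2 M
      _ = ℕ.m^n≢0 (2 ℕ.* M) M
      _ = ℕ.m^n≢0 p m
      _ = ℕ.m^n≢0 q′ m′

    powers : (p ℕ.* q′) ℕ.^ M ℕ.≤ 2 ℕ.* (p′ ℕ.* q) ℕ.^ M
    powers = ℕ.*-cancelʳ-≤ _ _ ((2 ℕ.* M) ℕ.^ M) (begin
      (p ℕ.* q′) ℕ.^ M ℕ.* (2 ℕ.* M) ℕ.^ M             ≡⟨ ^-distribʳ-* (p ℕ.* q′) (2 ℕ.* M) M ⟨
      (p ℕ.* q′ ℕ.* (2 ℕ.* M)) ℕ.^ M                   ≤⟨ ℕ.^-monoˡ-≤ M h ⟩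
      (p′ ℕ.* q ℕ.* suc (2 ℕ.* M)) ℕ.^ M               ≡⟨ ^-distribʳ-* (p′ ℕ.* q) (suc (2 ℕ.* M)) M ⟩
      (p′ ℕ.* q) ℕ.^ M ℕ.* suc (2 ℕ.* M) ℕ.^ M         ≤⟨ ℕ.*-monoʳ-≤ ((p′ ℕ.* q) ℕ.^ M) ([1+2M]^M≤2[2M]^M M) ⟩
      (p′ ℕ.* q) ℕ.^ M ℕ.* (2 ℕ.* (2 ℕ.* M) ℕ.^ M)     ≡⟨ lem ((p′ ℕ.* q) ℕ.^ M) ((2 ℕ.* M) ℕ.^ M) ⟩
      2 ℕ.* (p′ ℕ.* q) ℕ.^ M ℕ.* (2 ℕ.* M) ℕ.^ M       ∎)
      where
      open ℕ.≤-Reasoning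
      lem : ∀ x y → x ℕ.* (2 ℕ.* y) ≡ 2 ℕ.* x ℕ.* y
      lem = ℕ-solve-∀

    pow-assoc : ∀ x i j k → i ℕ.* j ≡ k → (x ℕ.^ i) ℕ.^ j ≡ x ℕ.^ k
    pow-assoc x i j k eq = trans (^-*-assoc x i j) (cong (x ℕ.^_) eq)

    eq₁ : ∀ m m′ M → m ℕ.* (m′ ℕ.* M) ≡ m ℕ.* m′ ℕ.* M
    eq₁ = ℕ-solve-∀
    eq₂ : ∀ m m′ M → m′ ℕ.* (m ℕ.* M) ≡ m ℕ.* m′ ℕ.* M
    eq₂ = ℕ-solve-∀
    eq₃ : ∀ m m′ M → M ℕ.* (m ℕ.* m′) ≡ m ℕ.* m′ ℕ.* M
    eq₃ = ℕ-solve-∀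

    lower : 2 ℕ.^ (a ℕ.* (m′ ℕ.* M) ℕ.+ b′ ℕ.* (m ℕ.* M)) ℕ.≤ (p ℕ.* q′) ℕ.^ E
    lower = begin
      2 ℕ.^ (a ℕ.* (m′ ℕ.* M) ℕ.+ b′ ℕ.* (m ℕ.* M))
        ≡⟨ ^-distribˡ-+-* 2 (a ℕ.* (m′ ℕ.* M)) (b′ ℕ.* (m ℕ.* M)) ⟩
      2 ℕ.^ (a ℕ.* (m′ ℕ.* M)) ℕ.* 2 ℕ.^ (b′ ℕ.* (m ℕ.* M))
        ≡⟨ cong₂ ℕ._*_ (^-*-assoc 2 a (m′ ℕ.* M)) (^-*-assoc 2 b′ (m ℕ.* M)) ⟨
      (2 ℕ.^ a) ℕ.^ (m′ ℕ.* M) ℕ.* (2 ℕ.^ b′) ℕ.^ (m ℕ.* M)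
        ≤⟨ ℕ.*-mono-≤ (ℕ.^-monoˡ-≤ (m′ ℕ.* M) (2^⌊log₂⌋≤ (p ℕ.^ m)))
                      (ℕ.^-monoˡ-≤ (m ℕ.* M) (2^⌊log₂⌋≤ (q′ ℕ.^ m′))) ⟩
      (p ℕ.^ m) ℕ.^ (m′ ℕ.* M) ℕ.* (q′ ℕ.^ m′) ℕ.^ (m ℕ.* M)
        ≡⟨ cong₂ ℕ._*_ (pow-assoc p m (m′ ℕ.* M) E (eq₁ m m′ M)) (pow-assoc q′ m′ (m ℕ.* M) E (eq₂ m m′ M)) ⟩
      p ℕ.^ E ℕ.* q′ ℕ.^ E
        ≡⟨ ^-distribʳ-* p q′ E ⟨
      (p ℕ.* q′) ℕ.^ E ∎
      where open ℕ.≤-Reasoning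

    upper : (p′ ℕ.* q) ℕ.^ E ℕ.≤ 2 ℕ.^ (suc a′ ℕ.* (m ℕ.* M) ℕ.+ suc b ℕ.* (m′ ℕ.* M))
    upper = begin
      (p′ ℕ.* q) ℕ.^ E
        ≡⟨ ^-distribʳ-* p′ q E ⟩
      p′ ℕ.^ E ℕ.* q ℕ.^ E
        ≡⟨ cong₂ ℕ._*_ (pow-assoc p′ m′ (m ℕ.* M) E (eq₂ m m′ M)) (pow-assoc q m (m′ ℕ.* M) E (eq₁ m m′ M)) ⟨
      (p′ ℕ.^ m′) ℕ.^ (m ℕ.* M) ℕ.* (q ℕ.^ m) ℕ.^ (m′ ℕ.* M)
        ≤⟨ ℕ.*-mono-≤ (ℕ.^-monoˡ-≤ (m ℕ.* M) (≤2^1+⌊log₂⌋ (p′ ℕ.^ m′)))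
                      (ℕ.^-monoˡ-≤ (m′ ℕ.* M) (≤2^1+⌊log₂⌋ (q ℕ.^ m))) ⟩
      (2 ℕ.^ suc a′) ℕ.^ (m ℕ.* M) ℕ.* (2 ℕ.^ suc b) ℕ.^ (m′ ℕ.* M)
        ≡⟨ cong₂ ℕ._*_ (^-*-assoc 2 (suc a′) (m ℕ.* M)) (^-*-assoc 2 (suc b) (m′ ℕ.* M)) ⟩
      2 ℕ.^ (suc a′ ℕ.* (m ℕ.* M)) ℕ.* 2 ℕ.^ (suc b ℕ.* (m′ ℕ.* M))
        ≡⟨ ^-distribˡ-+-* 2 (suc a′ ℕ.* (m ℕ.* M)) (suc b ℕ.* (m′ ℕ.* M)) ⟨
      2 ℕ.^ (suc a′ ℕ.* (m ℕ.* M) ℕ.+ suc b ℕ.* (m′ ℕ.* M)) ∎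
      where open ℕ.≤-Reasoning

    exponents : a ℕ.* (m′ ℕ.* M) ℕ.+ b′ ℕ.* (m ℕ.* M) ℕ.≤
                m ℕ.* m′ ℕ.+ (suc a′ ℕ.* (m ℕ.* M) ℕ.+ suc b ℕ.* (m′ ℕ.* M))
    exponents = 2^-cancel-≤ (begin
      2 ℕ.^ (a ℕ.* (m′ ℕ.* M) ℕ.+ b′ ℕ.* (m ℕ.* M))
        ≤⟨ lower ⟩
      (p ℕ.* q′) ℕ.^ E
        ≡⟨ pow-assoc (p ℕ.* q′) M (m ℕ.* m′) E (eq₃ m m′ M) ⟨
      ((p ℕ.* q′) ℕ.^ M) ℕ.^ (m ℕ.* m′)
        ≤⟨ ℕ.^-monoˡ-≤ (m ℕ.* m′) powers ⟩
      (2 ℕ.* (p′ ℕ.* q) ℕ.^ M) ℕ.^ (m ℕ.* m′)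
        ≡⟨ ^-distribʳ-* 2 ((p′ ℕ.* q) ℕ.^ M) (m ℕ.* m′) ⟩
      2 ℕ.^ (m ℕ.* m′) ℕ.* ((p′ ℕ.* q) ℕ.^ M) ℕ.^ (m ℕ.* m′)
        ≡⟨ cong (2 ℕ.^ (m ℕ.* m′) ℕ.*_) (pow-assoc (p′ ℕ.* q) M (m ℕ.* m′) E (eq₃ m m′ M)) ⟩
      2 ℕ.^ (m ℕ.* m′) ℕ.* (p′ ℕ.* q) ℕ.^ E
        ≤⟨ ℕ.*-monoʳ-≤ (2 ℕ.^ (m ℕ.* m′)) upper ⟩
      2 ℕ.^ (m ℕ.* m′) ℕ.* 2 ℕ.^ (suc a′ ℕ.* (m ℕ.* M) ℕ.+ suc b ℕ.* (m′ ℕ.* M))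
        ≡⟨ ^-distribˡ-+-* 2 (m ℕ.* m′) _ ⟨
      2 ℕ.^ (m ℕ.* m′ ℕ.+ (suc a′ ℕ.* (m ℕ.* M) ℕ.+ suc b ℕ.* (m′ ℕ.* M))) ∎)
      where open ℕ.≤-Reasoning

  ⌊log₂⌋-bound : a ℕ.* (m′ ℕ.* M) ℕ.+ b′ ℕ.* (m ℕ.* M) ℕ.≤
                 a′ ℕ.* (m ℕ.* M) ℕ.+ b ℕ.* (m′ ℕ.* M) ℕ.+ 3 ℕ.* (m ℕ.* m′)
  ⌊log₂⌋-bound = begin
    a ℕ.* (m′ ℕ.* M) ℕ.+ b′ ℕ.* (m ℕ.* M)
      ≤⟨ exponents ⟩
    m ℕ.* m′ ℕ.+ (suc a′ ℕ.* (m ℕ.* M) ℕ.+ suc b ℕ.* (m′ ℕ.* M))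
      ≡⟨ lem₁ (m ℕ.* m′) a′ b (m ℕ.* M) (m′ ℕ.* M) ⟩
    a′ ℕ.* (m ℕ.* M) ℕ.+ b ℕ.* (m′ ℕ.* M) ℕ.+ (m ℕ.* m′ ℕ.+ (m ℕ.* M ℕ.+ m′ ℕ.* M))
      ≤⟨ ℕ.+-monoʳ-≤ (a′ ℕ.* (m ℕ.* M) ℕ.+ b ℕ.* (m′ ℕ.* M))
           (ℕ.+-monoʳ-≤ (m ℕ.* m′) (ℕ.+-mono-≤ (ℕ.*-monoʳ-≤ m M≤m′) (ℕ.*-monoʳ-≤ m′ M≤m))) ⟩
    a′ ℕ.* (m ℕ.* M) ℕ.+ b ℕ.* (m′ ℕ.* M) ℕ.+ (m ℕ.* m′ ℕ.+ (m ℕ.* m′ ℕ.+ m′ ℕ.* m))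
      ≡⟨ lem₂ (a′ ℕ.* (m ℕ.* M) ℕ.+ b ℕ.* (m′ ℕ.* M)) m m′ ⟩
    a′ ℕ.* (m ℕ.* M) ℕ.+ b ℕ.* (m′ ℕ.* M) ℕ.+ 3 ℕ.* (m ℕ.* m′) ∎
    where
    open ℕ.≤-Reasoning
    lem₁ : ∀ k a b u v → k ℕ.+ ((1 ℕ.+ a) ℕ.* u ℕ.+ (1 ℕ.+ b) ℕ.* v) ≡
                         a ℕ.* u ℕ.+ b ℕ.* v ℕ.+ (k ℕ.+ (u ℕ.+ v))
    lem₁ = ℕ-solve-∀
    lem₂ : ∀ x m n → x ℕ.+ (m ℕ.* n ℕ.+ (m ℕ.* n ℕ.+ n ℕ.* m)) ≡ x ℕ.+ 3 ℕ.* (m ℕ.* n)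
    lem₂ = ℕ-solve-∀

-- If s = p / q and m = k + 1, then log₂ s = (log₂ pᵐ − log₂ qᵐ) / m, so for
-- s > 0 the value below differs from log₂ s by less than 1 / m.
log₂-approx : ℕ → ℚ → ℚ
log₂-approx k s =
  (+ ⌊log₂ ℤ.∣ ↥ s ∣ ℕ.^ suc k ⌋ ℤ.- + ⌊log₂ ↧ₙ s ℕ.^ suc k ⌋) / suc k

toℚᵘ-/ : ∀ i k → toℚᵘ (i / suc k) ℚᵘ.≃ mkℚᵘ i k
toℚᵘ-/ i k = ℚ.toℚᵘ-fromℚᵘ (mkℚᵘ i k)

toℕ-≤ : ∀ s s′ {p p′} c d → ↥ s ≡ + p → ↥ s′ ≡ + p′ →
        s ℚ.* (+ c / 1) ℚ.≤ s′ ℚ.* (+ d / 1) →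
        p ℕ.* ↧ₙ s′ ℕ.* c ℕ.≤ p′ ℕ.* ↧ₙ s ℕ.* d
toℕ-≤ s@(mkℚ (+ p) q _) s′@(mkℚ (+ p′) q′ _) c d refl refl h =
  subst₂ ℕ._≤_ (lem p c (suc q′)) (lem p′ d (suc q))
    (ℤ.drop‿+≤+ (subst₂ ℤ._≤_ (eq p c q′) (eq p′ d q) (ℚᵘ.drop-*≤* h′)))
  where
  h′ : mkℚᵘ (+ p) q ℚᵘ.* mkℚᵘ (+ c) 0 ℚᵘ.≤ mkℚᵘ (+ p′) q′ ℚᵘ.* mkℚᵘ (+ d) 0
  h′ = begin
    mkℚᵘ (+ p) q ℚᵘ.* mkℚᵘ (+ c) 0       ≃⟨ ℚᵘ.*-congˡ {mkℚᵘ (+ p) q} (ℚᵘ.≃-sym (toℚᵘ-/ (+ c) 0)) ⟩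
    toℚᵘ s ℚᵘ.* toℚᵘ (+ c / 1)           ≃⟨ ℚᵘ.≃-sym (ℚ.toℚᵘ-homo-* s (+ c / 1)) ⟩
    toℚᵘ (s ℚ.* (+ c / 1))               ≤⟨ ℚ.toℚᵘ-mono-≤ h ⟩
    toℚᵘ (s′ ℚ.* (+ d / 1))              ≃⟨ ℚ.toℚᵘ-homo-* s′ (+ d / 1) ⟩
    toℚᵘ s′ ℚᵘ.* toℚᵘ (+ d / 1)          ≃⟨ ℚᵘ.*-congˡ {mkℚᵘ (+ p′) q′} (toℚᵘ-/ (+ d) 0) ⟩
    mkℚᵘ (+ p′) q′ ℚᵘ.* mkℚᵘ (+ d) 0     ∎
    where open ℚᵘ.≤-Reasoning
  eq : ∀ p c r → (+ p ℤ.* + c) ℤ.* (+ (suc r ℕ.* 1)) ≡ + (p ℕ.* c ℕ.* (suc r ℕ.* 1))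
  eq p c r = trans (cong (ℤ._* + (suc r ℕ.* 1)) (sym (ℤ.pos-* p c))) (sym (ℤ.pos-* (p ℕ.* c) (suc r ℕ.* 1)))
  lem : ∀ p c r → p ℕ.* c ℕ.* (r ℕ.* 1) ≡ p ℕ.* r ℕ.* c
  lem = ℕ-solve-∀

log₂-approx-bound : ∀ M k k′ s s′ → suc M ℕ.≤ suc k → suc M ℕ.≤ suc k′ →
  0ℚ ℚ.< s → 0ℚ ℚ.< s′ →
  s ℚ.* (+ (2 ℕ.* suc M) / 1) ℚ.≤ s′ ℚ.* (+ suc (2 ℕ.* suc M) / 1) →
  log₂-approx k s ℚ.≤ log₂-approx k′ s′ ℚ.+ + 3 / suc M
log₂-approx-bound M k k′ (mkℚ (+ zero) _ _) s′ _ _ (*<* (ℤ.+<+ ())) _ _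
log₂-approx-bound M k k′ (mkℚ (ℤ.-[1+ _ ]) _ _) s′ _ _ (*<* ()) _ _
log₂-approx-bound M k k′ s@(mkℚ (ℤ.+[1+ _ ]) _ _) (mkℚ (+ zero) _ _) _ _ _ (*<* (ℤ.+<+ ())) _
log₂-approx-bound M k k′ s@(mkℚ (ℤ.+[1+ _ ]) _ _) (mkℚ (ℤ.-[1+ _ ]) _ _) _ _ _ (*<* ()) _
log₂-approx-bound M k k′ s@(mkℚ (ℤ.+[1+ p ]) q _) s′@(mkℚ (ℤ.+[1+ p′ ]) q′ _) M≤k M≤k′ _ _ h =
  ℚ.toℚᵘ-cancel-≤ (begin
    toℚᵘ (log₂-approx k s)                                   ≃⟨ toℚᵘ-/ (+ a ℤ.- + b) k ⟩
    mkℚᵘ (+ a ℤ.- + b) k                                     ≤⟨ ℚᵘ.*≤* goal ⟩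
    mkℚᵘ (+ a′ ℤ.- + b′) k′ ℚᵘ.+ mkℚᵘ (+ 3) M                ≃⟨ ℚᵘ.+-cong (ℚᵘ.≃-sym (toℚᵘ-/ (+ a′ ℤ.- + b′) k′)) (ℚᵘ.≃-sym (toℚᵘ-/ (+ 3) M)) ⟩
    toℚᵘ (log₂-approx k′ s′) ℚᵘ.+ toℚᵘ (+ 3 / suc M)         ≃⟨ ℚᵘ.≃-sym (ℚ.toℚᵘ-homo-+ (log₂-approx k′ s′) (+ 3 / suc M)) ⟩
    toℚᵘ (log₂-approx k′ s′ ℚ.+ + 3 / suc M)                 ∎)
  where
  open ℚᵘ.≤-Reasoning
  m m′ n a b a′ b′ : ℕ
  m  = suc k
  m′ = suc k′
  n  = suc M
  a  = ⌊log₂ suc p ℕ.^ m ⌋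
  b  = ⌊log₂ suc q ℕ.^ m ⌋
  a′ = ⌊log₂ suc p′ ℕ.^ m′ ⌋
  b′ = ⌊log₂ suc q′ ℕ.^ m′ ⌋
  nat : a ℕ.* (m′ ℕ.* n) ℕ.+ b′ ℕ.* (m ℕ.* n) ℕ.≤
        a′ ℕ.* (m ℕ.* n) ℕ.+ b ℕ.* (m′ ℕ.* n) ℕ.+ 3 ℕ.* (m ℕ.* m′)
  nat = ⌊log₂⌋-bound n m m′ (suc p) (suc q) (suc p′) (suc q′) M≤k M≤k′
          (toℕ-≤ s s′ (2 ℕ.* suc M) (suc (2 ℕ.* suc M)) refl refl h)
  pos₂ : ∀ x y z → + (x ℕ.* (y ℕ.* z)) ≡ + x ℤ.* (+ y ℤ.* + z)
  pos₂ x y z = trans (ℤ.pos-* x (y ℕ.* z)) (cong (+ x ℤ.*_) (ℤ.pos-* y z))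
  int : + a ℤ.* (+ m′ ℤ.* + n) ℤ.+ + b′ ℤ.* (+ m ℤ.* + n) ℤ.≤
        + a′ ℤ.* (+ m ℤ.* + n) ℤ.+ + b ℤ.* (+ m′ ℤ.* + n) ℤ.+ + 3 ℤ.* (+ m ℤ.* + m′)
  int = subst₂ ℤ._≤_
    (cong₂ ℤ._+_ (pos₂ a m′ n) (pos₂ b′ m n))
    (cong₂ ℤ._+_ (cong₂ ℤ._+_ (pos₂ a′ m n) (pos₂ b m′ n)) (pos₂ 3 m m′))
    (ℤ.+≤+ nat)
  lemˡ : ∀ A B A′ B′ m m′ n →
    (A ℤ.* (m′ ℤ.* n) ℤ.+ B′ ℤ.* (m ℤ.* n)) ℤ.- (B ℤ.* (m′ ℤ.* n) ℤ.+ B′ ℤ.* (m ℤ.* n)) ≡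
    (A ℤ.- B) ℤ.* (m′ ℤ.* n)
  lemˡ = ℤ-solve-∀
  lemʳ : ∀ A B A′ B′ m m′ n →
    (A′ ℤ.* (m ℤ.* n) ℤ.+ B ℤ.* (m′ ℤ.* n) ℤ.+ + 3 ℤ.* (m ℤ.* m′)) ℤ.- (B ℤ.* (m′ ℤ.* n) ℤ.+ B′ ℤ.* (m ℤ.* n)) ≡
    ((A′ ℤ.- B′) ℤ.* n ℤ.+ + 3 ℤ.* m′) ℤ.* m
  lemʳ = ℤ-solve-∀
  goal : (+ a ℤ.- + b) ℤ.* + (m′ ℕ.* n) ℤ.≤
         ((+ a′ ℤ.- + b′) ℤ.* + n ℤ.+ + 3 ℤ.* + m′) ℤ.* + m
  goal = subst₂ ℤ._≤_
    (trans (lemˡ (+ a) (+ b) (+ a′) (+ b′) (+ m) (+ m′) (+ n)) (cong ((+ a ℤ.- + b) ℤ.*_) (sym (ℤ.pos-* m′ n))))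
    (lemʳ (+ a) (+ b) (+ a′) (+ b′) (+ m) (+ m′) (+ n))
    (ℤ.+-monoˡ-≤ (ℤ.- (+ b ℤ.* (+ m′ ℤ.* + n) ℤ.+ + b′ ℤ.* (+ m ℤ.* + n))) int)

3/M<ε : ∀ ε → 0ℚ ℚ.< ε → ∃[ M ] (+ 3 / suc M) ℚ.< ε
3/M<ε (mkℚ (+ zero) _ _) (*<* (ℤ.+<+ ()))
3/M<ε (mkℚ (ℤ.-[1+ _ ]) _ _) (*<* ())
3/M<ε ε@(mkℚ (ℤ.+[1+ p ]) q _) _ = M ,
  ℚ.toℚᵘ-cancel-< (ℚᵘ.<-respˡ-≃ (ℚᵘ.≃-sym (toℚᵘ-/ (+ 3) M))
    (ℚᵘ.*<* (subst₂ ℤ._<_ (ℤ.pos-* 3 (suc q)) (ℤ.pos-* (suc p) (suc M)) (ℤ.+<+ lt))))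
  where
  M = q ℕ.+ 3 ℕ.* suc q
  lt : 3 ℕ.* suc q ℕ.< suc p ℕ.* suc M
  lt = ℕ.<-≤-trans (s≤s (ℕ.m≤n+m (3 ℕ.* suc q) q)) (ℕ.m≤n*m (suc M) (suc p))

-- The sequence depends on x alone; positivity is needed only for convergence.
log₂ : (x : ℝ) → 0ℝ < x → ℝ
log₂ x (ε₀ , 0<ε₀ , N₀ , ε₀≤x) = mkℝ (λ k → log₂-approx k (seq x k)) cau
  where
  cau : ∀ ε → 0ℚ ℚ.< ε → ∃[ N ] ∀ m n → N ℕ.≤ m → N ℕ.≤ n →
        ∣ log₂-approx m (seq x m) ℚ.- log₂-approx n (seq x n) ∣ ℚ.< ε
  cau ε 0<ε = N , λ m n N≤m N≤n → close (step m n N≤m N≤n) (step n m N≤n N≤m)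
    where
    M = proj₁ (3/M<ε ε 0<ε)
    C = + (2 ℕ.* suc M) / 1
    C-pos : ℚ.Positive C
    C-pos = ℚ.normalize-pos (2 ℕ.* suc M) 1
    δ-quot = quotient {ε₀} {C} 0<ε₀ (ℚ.positive⁻¹ C {{C-pos}})
    δ = proj₁ δ-quot
    x-cau = cauchy x δ (proj₁ (proj₂ δ-quot))
    N₁ = proj₁ x-cau
    N = N₀ ℕ.⊔ N₁ ℕ.⊔ M
    ≥ε₀ : ∀ n → N ℕ.≤ n → ε₀ ℚ.≤ seq x n
    ≥ε₀ n N≤n = subst (ℚ._≤ seq x n) (ℚ.+-identityˡ ε₀)
      (ε₀≤x n (ℕ.m⊔n≤o⇒m≤o N₀ N₁ (ℕ.m⊔n≤o⇒m≤o (N₀ ℕ.⊔ N₁) M N≤n)))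
    N₁≤ : ∀ {n} → N ℕ.≤ n → N₁ ℕ.≤ n
    N₁≤ N≤n = ℕ.m⊔n≤o⇒n≤o N₀ N₁ (ℕ.m⊔n≤o⇒m≤o (N₀ ℕ.⊔ N₁) M N≤n)
    M≤ : ∀ {n} → N ℕ.≤ n → suc M ℕ.≤ suc n
    M≤ N≤n = s≤s (ℕ.m⊔n≤o⇒n≤o (N₀ ℕ.⊔ N₁) M N≤n)
    suc-/1 : ∀ c → + suc c / 1 ≡ 1ℚ ℚ.+ + c / 1
    suc-/1 c = ℚ.toℚᵘ-injective
      (ℚᵘ.≃-trans (toℚᵘ-/ (+ suc c) 0)
      (ℚᵘ.≃-trans (ℚᵘ.*≡* (cong (ℤ._* + 1) (cong (λ i → + 1 ℤ.+ i) (sym (ℤ.*-identityʳ (+ c))))))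
      (ℚᵘ.≃-trans (ℚᵘ.+-congʳ (mkℚᵘ (+ 1) 0) (ℚᵘ.≃-sym (toℚᵘ-/ (+ c) 0)))
      (ℚᵘ.≃-sym (ℚ.toℚᵘ-homo-+ 1ℚ (+ c / 1))))))
    scaled : ∀ m n → N ℕ.≤ m → N ℕ.≤ n →
             seq x m ℚ.* C ℚ.≤ seq x n ℚ.* (+ suc (2 ℕ.* suc M) / 1)
    scaled m n N≤m N≤n = begin
      seq x m ℚ.* C                          ≤⟨ ℚ.*-monoʳ-≤-nonNeg C {{ℚ.pos⇒nonNeg C {{C-pos}}}}
                                                  (ℚ.<⇒≤ (∣p-q∣<ε⇒p<q+ε {seq x m} {seq x n} (proj₂ x-cau m n (N₁≤ N≤m) (N₁≤ N≤n)))) ⟩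
      (seq x n ℚ.+ δ) ℚ.* C                  ≡⟨ ℚ.*-distribʳ-+ C (seq x n) δ ⟩
      seq x n ℚ.* C ℚ.+ δ ℚ.* C              ≡⟨ cong (seq x n ℚ.* C ℚ.+_) (trans (ℚ.*-comm δ C) (proj₂ (proj₂ δ-quot))) ⟩
      seq x n ℚ.* C ℚ.+ ε₀                   ≤⟨ ℚ.+-monoʳ-≤ (seq x n ℚ.* C) (≥ε₀ n N≤n) ⟩
      seq x n ℚ.* C ℚ.+ seq x n              ≡⟨ lem (seq x n) C ⟩
      seq x n ℚ.* (1ℚ ℚ.+ C)                 ≡⟨ cong (seq x n ℚ.*_) (suc-/1 (2 ℕ.* suc M)) ⟨
      seq x n ℚ.* (+ suc (2 ℕ.* suc M) / 1)  ∎
      where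
      open ℚ.≤-Reasoning
      open +-*-Solver
      lem : ∀ s c → s ℚ.* c ℚ.+ s ≡ s ℚ.* (1ℚ ℚ.+ c)
      lem = solve 2 (λ s c → s :* c :+ s := s :* (con 1ℚ :+ c)) refl
    step : ∀ m n → N ℕ.≤ m → N ℕ.≤ n →
           log₂-approx m (seq x m) ℚ.< log₂-approx n (seq x n) ℚ.+ ε
    step m n N≤m N≤n = ℚ.≤-<-trans
      (log₂-approx-bound M m n (seq x m) (seq x n) (M≤ N≤m) (M≤ N≤n)
        (ℚ.<-≤-trans 0<ε₀ (≥ε₀ m N≤m)) (ℚ.<-≤-trans 0<ε₀ (≥ε₀ n N≤n)) (scaled m n N≤m N≤n))
      (ℚ.+-monoʳ-< (log₂-approx n (seq x n)) (proj₂ (3/M<ε ε 0<ε)))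

0<fromℕ : ∀ {k n} → suc k ℕ.≤ n → 0ℝ < fromℕ n
0<fromℕ {n = n} (s≤s _) = 1ℚ , ℚ.positive⁻¹ 1ℚ , 0 , λ _ _ →
  ℚ.toℚᵘ-cancel-≤ (ℚᵘ.≤-respʳ-≃ (ℚᵘ.≃-sym (toℚᵘ-/ (+ n) 0)) (ℚᵘ.*≤* (ℤ.+≤+ (s≤s z≤n))))

0<log₂ : ∀ {k n} (h : suc (suc k) ℕ.≤ n) → 0ℝ < log₂ (fromℕ n) (0<fromℕ h)
0<log₂ {n = n} h@(s≤s (s≤s _)) = 1ℚ , ℚ.positive⁻¹ 1ℚ , 0 , λ k _ → bound k
  where
  ≥1 : ∀ k i → + suc k ℤ.≤ i → 1ℚ ℚ.≤ i / suc k
  ≥1 k i le = ℚ.toℚᵘ-cancel-≤ (ℚᵘ.≤-respʳ-≃ (ℚᵘ.≃-sym (toℚᵘ-/ i k))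
    (ℚᵘ.*≤* (subst₂ ℤ._≤_ (sym (ℤ.*-identityˡ (+ suc k))) (sym (ℤ.*-identityʳ i)) le)))
  n/1 : + n / 1 ≡ mkℚ (+ n) 0 (Coprime.sym (Coprime.1-coprimeTo n))
  n/1 = ℚ.normalize-coprime (Coprime.sym (Coprime.1-coprimeTo n))
  bound : ∀ k → 0ℚ ℚ.+ 1ℚ ℚ.≤ log₂-approx k (+ n / 1)
  bound k = subst (λ s → 1ℚ ℚ.≤ log₂-approx k s) (sym n/1)
    (≥1 k (+ ⌊log₂ n ℕ.^ suc k ⌋ ℤ.- + ⌊log₂ 1 ℕ.^ suc k ⌋)
      (subst (λ l → + suc k ℤ.≤ + ⌊log₂ n ℕ.^ suc k ⌋ ℤ.- + ⌊log₂ l ⌋) (sym (ℕ.^-zeroˡ (suc k)))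
        (subst (+ suc k ℤ.≤_) (sym (ℤ.+-identityʳ (+ ⌊log₂ n ℕ.^ suc k ⌋)))
          (ℤ.+≤+ (subst (ℕ._≤ ⌊log₂ n ℕ.^ suc k ⌋) (⌊log₂[2^n]⌋≡n (suc k))
            (⌊log₂⌋-mono-≤ (ℕ.^-monoˡ-≤ (suc k) (s≤s (s≤s z≤n)))))))))

infix 8 ℤ^_ ℝ^_
infix 4 _≈ᵛ_

ℤ^_ : ℕ → Set
ℤ^ d = Vec ℤ d

ℝ^_ : ℕ → Set
ℝ^ d = Vector ℝ d

_≈ᵛ_ : ∀ {d} → ℝ^ d → ℝ^ d → Set
x ≈ᵛ y = ∀ i → x i ≈ y i

+-0-rawMonoid : RawMonoid 0ℓ 0ℓ
+-0-rawMonoid = record { Carrier = ℝ ; _≈_ = _≈_ ; _∙_ = _+_ ; ε = 0ℝ }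

open import Algebra.Definitions.RawMonoid +-0-rawMonoid public using (sum)

embed : ∀ {d} → ℤ^ d → ℝ^ d
embed x i = fromℤ (lookup x i)

image : ∀ {d} → Pred (ℤ^ d) 0ℓ → Pred (ℝ^ d) 0ℓ
image X y = ∃[ x ] (x ∈ X × y ≈ᵛ embed x)

range : ∀ {d m} → (Fin m → ℝ^ d) → Pred (ℝ^ d) 0ℓ
range p y = ∃[ j ] y ≈ᵛ p j

combination : ∀ {d m} → (Fin m → ℝ) → (Fin m → ℝ^ d) → ℝ^ d
combination c p i = sum (λ j → c j * p j i)

aff : ∀ {d} → Pred (ℝ^ d) 0ℓ → Pred (ℝ^ d) 0ℓ
aff {d} S y = ∃[ m ] ∃[ c ] ∃[ p ]
  ((∀ (j : Fin m) → p j ∈ S) × sum c ≈ 1ℝ × combination c p ≈ᵛ y)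

conv : ∀ {d} → Pred (ℝ^ d) 0ℓ → Pred (ℝ^ d) 0ℓ
conv {d} S y = ∃[ m ] ∃[ c ] ∃[ p ]
  ((∀ (j : Fin m) → p j ∈ S) × (∀ j → 0ℝ ≤ c j) × sum c ≈ 1ℝ × combination c p ≈ᵛ y)

AffinelyIndependent : ∀ {d m} → (Fin m → ℝ^ d) → Set
AffinelyIndependent p =
  ∀ c → sum c ≈ 0ℝ → combination c p ≈ᵛ (λ _ → 0ℝ) → ∀ j → c j ≈ 0ℝ

-- An affine basis of T has n + 1 points; in particular the empty set has no
-- dimension in this sense.
AffineDimension : ∀ {d} → Pred (ℝ^ d) 0ℓ → ℕ → Set
AffineDimension {d} T n =
  ∃[ p ] (AffinelyIndependent {d} {suc n} p × T ≐ aff (range p))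

Finite : ∀ {d} → Pred (ℤ^ d) 0ℓ → Set
Finite X = ∃[ xs ] X ≐ (_∈ₗ xs)

LatticeConvex : ∀ {d} → Pred (ℤ^ d) 0ℓ → Set
LatticeConvex X = (λ x → embed x ∈ conv (image X)) ≐ X

Dimension : ∀ {d} → Pred (ℤ^ d) 0ℓ → ℕ → Set
Dimension X = AffineDimension (aff (image X))

infixl 7 _·_

Matrix : ℕ → ℕ → Set
Matrix k d = Fin k → Fin d → ℝ

_·_ : ∀ {k d} → Matrix k d → ℝ^ d → ℝ^ k
(A · x) i = sum (λ j → A i j * x j)

DescribedBy : ∀ {d} → Pred (ℤ^ d) 0ℓ → ℕ → Set
DescribedBy {d} X k =
  Σ[ A ∈ Matrix k d ] Σ[ b ∈ ℝ^ k ]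
  ∃[ m ] Σ[ U ∈ Matrix m d ] Σ[ v ∈ ℝ^ m ]
    X ≐ (λ x → (∀ i → (A · embed x) i ≤ b i) × (U · embed x ≈ᵛ v))

RelaxationComplexity : ∀ {d} → Pred (ℤ^ d) 0ℓ → ℕ → Set
RelaxationComplexity X k = DescribedBy X k × (∀ j → DescribedBy X j → k ℕ.≤ j)

-- If n + 1 > (r + 1) 2^r, then more than r + 1 affinely independent points of X
-- share the set of inequalities that they satisfy with equality, since there
-- are at most 2^r such sets.  Fix r + 2 of them, y₀, …, y_{r+1}.  By Dirichlet's
-- pigeonhole argument the r + 1 differences y_j − y₀ have nontrivial integer
-- combinations Σ u_j (y_j − y₀) on which the r linear forms are arbitrarily
-- small; the forms of the tight inequalities and of the equations vanish on
-- every such combination.  So y₀ + R Σ u_j (y_j − y₀) satisfies the whole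
-- system for any prescribed modulus R, hence lies in X, and it is congruent to
-- y₀ modulo R.  For R larger than all coordinate differences in X it equals y₀,
-- contradicting affine independence.
--
-- From n + 1 ≤ a 2^r and a ≤ log₂ n, where a is r + 1 or 2, the bound follows.
module Submission where

open import Defs using (^-distribʳ-*)
open import Algebra.Bundles using (CommutativeRing)
import Algebra.Properties.AbelianGroup
import Algebra.Properties.Semiring.Sum as Sums
open import Data.Fin.Base as Fin using (Fin; toℕ; fromℕ<; finToFun; funToFin; punchIn; _↑ˡ_; _↑ʳ_)
import Data.Fin.Properties as Fin
open import Data.Integer.Base as ℤ using (ℤ; +_)
import Data.Integer.Properties as ℤ
open import Data.Integer.Tactic.RingSolver using () renaming (solve-∀ to ℤ-solve-∀)
open import Data.List.Base using (List; []; _∷_)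
open import Data.List.Membership.Propositional using () renaming (_∈_ to _∈ₗ_)
open import Data.List.Relation.Unary.Any using (here; there)
open import Data.Nat as ℕ using (ℕ; zero; suc; z≤n; s≤s)
import Data.Nat.Properties as ℕ
open import Data.Nat.Tactic.RingSolver using () renaming (solve-∀ to ℕ-solve-∀)
open import Data.Product.Base using (∃-syntax; Σ-syntax; _×_; _,_; proj₁; proj₂)
open import Data.Sum.Base using (_⊎_; inj₁; inj₂)
open import Data.Vec.Base using (Vec; lookup; tabulate)
open import Data.Vec.Functional using (insertAt) renaming (_∷_ to _∷ᶠ_; _++_ to _++ᶠ_)
open import Data.Vec.Functional.Properties using
  (insertAt-lookup; insertAt-punchIn; lookup-++ˡ; lookup-++ʳ)
open import Data.Vec.Properties using (lookup∘tabulate)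
open import Function.Base using (_∘_; case_of_)
open import Level using (0ℓ; _⊔_)
open import Relation.Binary.PropositionalEquality as ≡ using (_≡_)
open import Relation.Nullary using (¬_; yes; no; contradiction)
open import Relation.Nullary.Decidable using (¬¬-excluded-middle)

-- Linear algebra

-- Equality of Cauchy reals is undecidable, and this shapes everything up to the bound n + 1 ≤ (r +
-- 1) 2^r. Whether an inequality is tight, a vector lies in a span or a pivot is nonzero is settled
-- only under double negation. The bound itself compares natural numbers, hence is stable, and there
-- the double negations are discharged.
--
-- The given affine basis consists of points of the affine hull, not of X, so it cannot be sorted by
-- tight sets. The count runs from the other side: each class of points of X with the same tight set
-- lies in the affine span of at most r + 1 of its members, so X lies in the affine span of at most
-- (r + 1) 2^r points. A leading coordinate 1 makes affine notions linear.
--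
-- Two kinds of independence meet: spans are taken over the reals, while Dirichlet's coefficients
-- are integers and contradict independence over the integers. The passage between them inverts a
-- nonzero integer.
--
-- Strictness comes from having n + 1 in place of n: log₂ (n + 1) - log₂ n ≥ 1 / n leaves a gap that
-- survives the rounding in the approximate logarithms.

module Spans {c ℓ} (R : CommutativeRing c ℓ) where
  open CommutativeRing R
  open Sums semiring
  open import Algebra.Properties.Ring ring using (-‿distribˡ-*; -‿distribʳ-*)
  open import Relation.Binary.Reasoning.Setoid setoid

  sum-zero : ∀ {n} (t : Fin n → Carrier) → (∀ j → t j ≈ 0#) → sum t ≈ 0#
  sum-zero {n} t t≈0 = trans (sum-cong-≋ t≈0) (sum-replicate-zero n)

  InSpan : ∀ {m n} → (Fin n → Fin m → Carrier) → (Fin m → Carrier) → Set (c ⊔ ℓ)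
  InSpan {n = n} g v = Σ[ e ∈ (Fin n → Carrier) ] ∀ i → sum (λ k → e k * g k i) ≈ v i

  span-generator : ∀ {m n} (g : Fin n → Fin m → Carrier) k → InSpan g (g k)
  span-generator {n = suc n} g Fin.zero = e , λ i → begin
    1# * g Fin.zero i + sum (λ k → 0# * g (Fin.suc k) i)
      ≈⟨ +-cong (*-identityˡ _) (sum-zero _ λ k → zeroˡ (g (Fin.suc k) i)) ⟩
    g Fin.zero i + 0#
      ≈⟨ +-identityʳ _ ⟩
    g Fin.zero i ∎
    where
    e : Fin (suc n) → Carrier
    e Fin.zero    = 1#
    e (Fin.suc _) = 0#
  span-generator {n = suc n} g (Fin.suc k) with span-generator (g ∘ Fin.suc) k
  ... | e , h = e′ , λ i → trans (+-congʳ (zeroˡ _)) (trans (+-identityˡ _) (h i))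
    where
    e′ : Fin (suc n) → Carrier
    e′ Fin.zero    = 0#
    e′ (Fin.suc j) = e j

  combination-span : ∀ {l m n} {g : Fin n → Fin m → Carrier} {h : Fin l → Fin m → Carrier}
    (a : ∀ k → InSpan h (g k)) (w : Fin n → Carrier) (i : Fin m) →
    sum (λ k → w k * g k i) ≈ sum (λ j → sum (λ k → w k * proj₁ (a k) j) * h j i)
  combination-span {l} {g = g} {h} a w i = begin
    sum (λ k → w k * g k i)
      ≈⟨ sum-cong-≋ (λ k → trans (*-congˡ (sym (proj₂ (a k) i))) (*-distribˡ-sum (w k) (λ j → proj₁ (a k) j * h j i))) ⟩
    sum (λ k → sum (λ j → w k * (proj₁ (a k) j * h j i)))
      ≈⟨ ∑-comm (λ k j → w k * (proj₁ (a k) j * h j i)) ⟩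
    sum (λ j → sum (λ k → w k * (proj₁ (a k) j * h j i)))
      ≈⟨ sum-cong-≋ (λ j → sum-cong-≋ (λ k → sym (*-assoc (w k) (proj₁ (a k) j) (h j i)))) ⟩
    sum (λ j → sum (λ k → w k * proj₁ (a k) j * h j i))
      ≈⟨ sum-cong-≋ {l} (λ j → sym (*-distribʳ-sum (h j i) (λ k → w k * proj₁ (a k) j))) ⟩
    sum (λ j → sum (λ k → w k * proj₁ (a k) j) * h j i) ∎

  span-trans : ∀ {l m n} {g : Fin n → Fin m → Carrier} {h : Fin l → Fin m → Carrier} {v} →
    (∀ k → InSpan h (g k)) → InSpan g v → InSpan h v
  span-trans a (w , eq) = _ , λ i → trans (sym (combination-span a w i)) (eq i)

  -- Knowing only that a real is not zero does not provide an inverse. Absence of zero divisors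
  -- takes the place of division, and stability of `≈ 0#` turns the failure to find a pivot into a
  -- row of zeros.
  module Kernel (1≉0 : ¬ 1# ≈ 0#)
                (≈0-stable : ∀ x → ¬ ¬ x ≈ 0# → x ≈ 0#)
                (noZeroDivisors : ∀ x y → x * y ≈ 0# → ¬ x ≈ 0# → y ≈ 0#) where

    private
      rearrange : ∀ b α c β w → (α * b - c * β) * w ≈ (- β) * (c * w) + b * (α * w)
      rearrange b α c β w = begin
        (α * b - c * β) * w              ≈⟨ distribʳ w (α * b) (- (c * β)) ⟩
        α * b * w + (- (c * β)) * w      ≈⟨ +-cong (trans (*-congʳ (*-comm α b)) (*-assoc b α w))
                                              (trans (*-congʳ (trans (-‿cong (*-comm c β)) (-‿distribˡ-* β c))) (*-assoc (- β) c w)) ⟩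
        b * (α * w) + (- β) * (c * w)    ≈⟨ +-comm _ _ ⟩
        (- β) * (c * w) + b * (α * w)    ∎

      swap-neg : ∀ b s → b * - s ≈ (- b) * s
      swap-neg b s = trans (sym (-‿distribʳ-* b s)) (-‿distribˡ-* b s)

      cancel : ∀ α c w → (α * c - c * α) * w ≈ 0#
      cancel α c w = trans (*-congʳ (trans (+-congʳ (*-comm α c)) (-‿inverseʳ (c * α)))) (zeroˡ w)

    -- Fraction-free elimination of one column by a nonzero entry of the first row.
    nontrivial-kernel : ∀ {m n} → m ℕ.< n → (a : Fin m → Fin n → Carrier) →
      ¬ ¬ (Σ[ w ∈ (Fin n → Carrier) ] ((∀ i → sum (λ j → a i j * w j) ≈ 0#) × ¬ (∀ j → w j ≈ 0#)))
    nontrivial-kernel {zero} {suc n} _ a k = k ((λ _ → 1#) , (λ ()) , λ z → 1≉0 (z Fin.zero))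
    nontrivial-kernel {suc m} {suc n} (s≤s m<n) a k = ¬¬-excluded-middle λ
      { (no ¬pivot) → nontrivial-kernel (ℕ.≤-trans m<n (ℕ.n≤1+n n)) (a ∘ Fin.suc) λ (w , eq , w≉0) →
          k (w , (λ { Fin.zero → sum-zero _ (λ j → trans (*-congʳ (≈0-stable _ λ ≉0 → ¬pivot (j , ≉0))) (zeroˡ (w j)))
                    ; (Fin.suc i) → eq i })
               , w≉0)
      ; (yes (p , α≉0)) → eliminate p α≉0 }
      where
      eliminate : ∀ p → ¬ a Fin.zero p ≈ 0# → _
      eliminate p α≉0 = nontrivial-kernel m<n (λ i → reduced (a (Fin.suc i))) λ (w , eq , w≉0) →
        k (lift w , (λ { Fin.zero → trans (row w (a Fin.zero)) (sum-zero _ λ j → cancel α (a Fin.zero (punchIn p j)) (w j))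
                       ; (Fin.suc i) → trans (row w (a (Fin.suc i))) (eq i) })
                  , λ z → w≉0 λ j → noZeroDivisors α (w j)
                      (≡.subst (_≈ 0#) (insertAt-punchIn _ p (pivot-value w) j) (z (punchIn p j))) α≉0)
        where
        α = a Fin.zero p
        reduced : (Fin (suc n) → Carrier) → Fin n → Carrier
        reduced b j = α * b (punchIn p j) - a Fin.zero (punchIn p j) * b p
        -- Solving the first row for this entry would divide by `α`; scaling all other entries by
        -- `α` avoids that.
        pivot-value : (Fin n → Carrier) → Carrier
        pivot-value w = - sum (λ j → a Fin.zero (punchIn p j) * w j)
        lift : (Fin n → Carrier) → Fin (suc n) → Carrier
        lift w = insertAt (λ j → α * w j) p (pivot-value w)
        row : ∀ w b → sum (λ j → b j * lift w j) ≈ sum (λ j → reduced b j * w j)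
        row w b = begin
          sum (λ j → b j * lift w j)
            ≈⟨ sum-remove {i = p} (λ j → b j * lift w j) ⟩
          b p * lift w p + sum (λ j → b (punchIn p j) * lift w (punchIn p j))
            ≡⟨ ≡.cong (λ x → b p * x + sum (λ j → b (punchIn p j) * lift w (punchIn p j)))
                 (insertAt-lookup (λ j → α * w j) p (pivot-value w)) ⟩
          b p * pivot-value w + sum (λ j → b (punchIn p j) * lift w (punchIn p j))
            ≈⟨ +-cong (trans (swap-neg _ _) (*-distribˡ-sum (- b p) (λ j → a Fin.zero (punchIn p j) * w j)))
                 (sum-cong-≋ λ j → *-congˡ (reflexive (insertAt-punchIn _ p (pivot-value w) j))) ⟩
          sum (λ j → (- b p) * (a Fin.zero (punchIn p j) * w j)) + sum (λ j → b (punchIn p j) * (α * w j))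
            ≈⟨ ∑-distrib-+ (λ j → (- b p) * (a Fin.zero (punchIn p j) * w j)) (λ j → b (punchIn p j) * (α * w j)) ⟨
          sum (λ j → (- b p) * (a Fin.zero (punchIn p j) * w j) + b (punchIn p j) * (α * w j))
            ≈⟨ sum-cong-≋ (λ j → sym (rearrange (b (punchIn p j)) α (a Fin.zero (punchIn p j)) (b p) (w j))) ⟩
          sum (λ j → reduced b j * w j) ∎

    -- The coefficients of the `g k` over `h` form an l × n matrix with l < n; a kernel vector of it
    -- is a relation among the `g k`.
    span-dependent : ∀ {l m n} {g : Fin n → Fin m → Carrier} {h : Fin l → Fin m → Carrier} →
      l ℕ.< n → (∀ k → InSpan h (g k)) →
      ¬ ¬ (Σ[ w ∈ (Fin n → Carrier) ] ((∀ i → sum (λ k → w k * g k i) ≈ 0#) × ¬ (∀ k → w k ≈ 0#)))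
    span-dependent {g = g} {h} l<n a k = nontrivial-kernel l<n (λ j k → proj₁ (a k) j) λ (w , eq , w≉0) →
      k (w , (λ i → trans (combination-span a w i) (sum-zero _ λ j →
        trans (*-congʳ (trans (sum-cong-≋ λ k → *-comm (w k) (proj₁ (a k) j)) (eq j))) (zeroˡ (h j i)))) , w≉0)

-- Archimedean domains

-- The multiplier κ in ¬¬-slack is 3 / ε for some ε > 0 with x + ε ≤ y.
record ArchimedeanDomain : Set₁ where
  infix 4 _≤_
  field
    commutativeRing : CommutativeRing _ _
  open CommutativeRing commutativeRing public
  field
    1≉0             : ¬ 1# ≈ 0#
    ≈0-stable       : ∀ x → ¬ ¬ x ≈ 0# → x ≈ 0#
    noZeroDivisors  : ∀ x y → x * y ≈ 0# → ¬ x ≈ 0# → y ≈ 0#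
    _≤_             : Carrier → Carrier → Set
    ≤-reflexive     : ∀ {x y} → x ≈ y → x ≤ y
    ≤-trans         : ∀ {x y z} → x ≤ y → y ≤ z → x ≤ z
    +-mono-≤        : ∀ {x y u v} → x ≤ y → u ≤ v → x + u ≤ y + v
    ι               : ℤ → Carrier
    ι-+             : ∀ i j → ι (i ℤ.+ j) ≈ ι i + ι j
    ι-*             : ∀ i j → ι (i ℤ.* j) ≈ ι i * ι j
    ι-1             : ι (+ 1) ≈ 1#
    ι-mono-≤        : ∀ {i j} → i ℤ.≤ j → ι i ≤ ι j
    ι-cancel-≤      : ∀ {i j} → ι i ≤ ι j → i ℤ.≤ j
    ι-inverse       : ∀ i → ¬ i ≡ + 0 → ∃[ y ] y * ι i ≈ 1#
    approxFloor     : ∀ x → ∃[ k ] (ι k ≤ x × x ≤ ι (k ℤ.+ + 3))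
    ¬¬-slack        : ∀ {x y} → x ≤ y → ¬ x ≈ y →
                      ¬ ¬ (∃[ κ ] ∀ v → κ * v ≤ ι (+ 3) → x + v ≤ y)

-- Simultaneous approximation by the pigeonhole principle

private module ℤ-group = Algebra.Properties.AbelianGroup ℤ.+-0-abelianGroup

finite-bound : ∀ {n} (P : Fin n → ℕ → Set) → (∀ i {a b} → a ℕ.≤ b → P i a → P i b) →
  (∀ i → ∃[ b ] P i b) → ∃[ b ] ∀ i → P i b
finite-bound {zero}  P mono bs = 0 , λ ()
finite-bound {suc n} P mono bs with bs Fin.zero | finite-bound (P ∘ Fin.suc) (mono ∘ Fin.suc) (bs ∘ Fin.suc)
... | b , p | c , q = b ℕ.⊔ c , λ
  { Fin.zero → mono Fin.zero (ℕ.m≤m⊔n b c) p ; (Fin.suc i) → mono (Fin.suc i) (ℕ.m≤n⊔m b c) (q i) }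

-- A value in [-V, V] between k and k + 3 forces -V - 3 ≤ k ≤ V. The shift by V + 3 numbers these 2V
-- + 4 levels from 0.
≤-box : ∀ V k → ℤ.- + V ℤ.≤ k ℤ.+ + 3 → k ℤ.≤ + V →
  Σ[ c ∈ Fin (4 ℕ.+ 2 ℕ.* V) ] + toℕ c ≡ k ℤ.+ + (3 ℕ.+ V)
≤-box V k lo hi = fromℕ< {∣k∣} (s≤s (ℤ.drop‿+≤+ (ℤ.≤-trans (ℤ.≤-reflexive +∣k∣) (ℤ.≤-trans
    (ℤ.+-monoˡ-≤ (+ (3 ℕ.+ V)) hi) (ℤ.≤-reflexive (≡.cong +_ (lem V))))))) ,
  ≡.trans (≡.cong +_ (Fin.toℕ-fromℕ< _)) +∣k∣
  where
  ∣k∣ = ℤ.∣ k ℤ.+ + (3 ℕ.+ V) ∣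
  lem : ∀ V → V ℕ.+ (3 ℕ.+ V) ≡ 3 ℕ.+ 2 ℕ.* V
  lem = ℕ-solve-∀
  0≤ : + 0 ℤ.≤ k ℤ.+ + (3 ℕ.+ V)
  0≤ = ≡.subst₂ ℤ._≤_ (ℤ.+-inverseˡ (+ V)) (ℤ.+-assoc k (+ 3) (+ V)) (ℤ.+-monoˡ-≤ (+ V) lo)
  +∣k∣ : + ∣k∣ ≡ k ℤ.+ + (3 ℕ.+ V)
  +∣k∣ = ℤ.0≤i⇒+∣i∣≡i 0≤

funToFin-cong : ∀ {m n} {f g : Fin m → Fin n} → (∀ j → f j ≡ g j) → funToFin f ≡ funToFin g
funToFin-cong {zero}  h = ≡.refl
funToFin-cong {suc m} h = ≡.cong₂ Fin.combine (h Fin.zero) (funToFin-cong (h ∘ Fin.suc))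

-- Digit vectors and box vectors are encoded as numbers below B^s and K^r, where the pigeonhole
-- principle applies. Distinctness is expressed pointwise, which is the form in which it survives
-- decoding.
pigeonhole-digits : ∀ {r s K B} → K ℕ.^ r ℕ.< B ℕ.^ s → (box : (Fin s → Fin B) → Fin r → Fin K) →
  Σ[ a ∈ (Fin s → Fin B) ] Σ[ b ∈ (Fin s → Fin B) ] (¬ (∀ j → a j ≡ b j) × (∀ i → box a i ≡ box b i))
pigeonhole-digits {r} {s} {K} {B} lt box with Fin.pigeonhole lt (λ a → funToFin (box (finToFun a)))
... | a , b , a<b , same = finToFun a , finToFun b ,
  (λ h → Fin.<-irrefl (≡.trans (≡.sym (Fin.funToFin-finToFin {s} {B} a))
           (≡.trans (funToFin-cong h) (Fin.funToFin-finToFin {s} {B} b))) a<b) ,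
  λ i → ≡.trans (≡.sym (Fin.finToFun-funToFin (box (finToFun a)) i))
    (≡.trans (≡.cong (λ c → finToFun c i) same) (Fin.finToFun-funToFin (box (finToFun b)) i))

-- The number K of levels per form grows only linearly with the largest digit B: K ≤ g (B + 1) with
-- g = 4 + 2 (r + 1) C. Hence K^r ≤ g^r (B + 1)^r, and the choice B = g^r lets the additional factor
-- B + 1 of the digit vectors win.
few-boxes : ∀ r C → let B = (4 ℕ.+ 2 ℕ.* (suc r ℕ.* C)) ℕ.^ r in
  (4 ℕ.+ 2 ℕ.* (suc r ℕ.* (B ℕ.* C))) ℕ.^ r ℕ.< suc B ℕ.^ suc r
few-boxes r C = begin-strict
  K ℕ.^ r                    ≤⟨ ℕ.^-monoˡ-≤ r K≤ ⟩
  (g ℕ.* suc B) ℕ.^ r        ≡⟨ ^-distribʳ-* g (suc B) r ⟩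
  B ℕ.* suc B ℕ.^ r          <⟨ ℕ.*-monoˡ-< (suc B ℕ.^ r) {{ℕ.m^n≢0 (suc B) r}} (ℕ.n<1+n B) ⟩
  suc B ℕ.* suc B ℕ.^ r      ∎
  where
  open ℕ.≤-Reasoning
  g = 4 ℕ.+ 2 ℕ.* (suc r ℕ.* C)
  B = g ℕ.^ r
  K = 4 ℕ.+ 2 ℕ.* (suc r ℕ.* (B ℕ.* C))
  lem : ∀ s B C → 4 ℕ.+ 2 ℕ.* (s ℕ.* (B ℕ.* C)) ℕ.+ (4 ℕ.* B ℕ.+ 2 ℕ.* (s ℕ.* C)) ≡
                  (4 ℕ.+ 2 ℕ.* (s ℕ.* C)) ℕ.* (1 ℕ.+ B)
  lem = ℕ-solve-∀
  K≤ : K ℕ.≤ g ℕ.* suc B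
  K≤ = ℕ.≤-trans (ℕ.m≤m+n K (4 ℕ.* B ℕ.+ 2 ℕ.* (suc r ℕ.* C))) (ℕ.≤-reflexive (lem (suc r) B C))

module Dirichlet (D : ArchimedeanDomain) where
  open ArchimedeanDomain D
  open Spans commutativeRing
  open Sums semiring
  open import Algebra.Properties.AbelianGroup +-abelianGroup using (xyx⁻¹≈y)
  open import Relation.Binary.Reasoning.Setoid setoid

  ι-0 : ι (+ 0) ≈ 0#
  ι-0 = begin
    ι (+ 0)                           ≈⟨ +-identityʳ _ ⟨
    ι (+ 0) + 0#                      ≈⟨ +-congˡ (-‿inverseʳ (ι (+ 0))) ⟨
    ι (+ 0) + (ι (+ 0) - ι (+ 0))     ≈⟨ +-assoc _ _ _ ⟨
    ι (+ 0) + ι (+ 0) - ι (+ 0)       ≈⟨ +-congʳ (ι-+ (+ 0) (+ 0)) ⟨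
    ι (+ 0) - ι (+ 0)                 ≈⟨ -‿inverseʳ (ι (+ 0)) ⟩
    0#                                ∎

  Bounded : Carrier → ℕ → Set
  Bounded x b = ι (ℤ.- + b) ≤ x × x ≤ ι (+ b)

  bounded-mono : ∀ {x a b} → a ℕ.≤ b → Bounded x a → Bounded x b
  bounded-mono a≤b (lo , hi) =
    ≤-trans (ι-mono-≤ (ℤ.neg-mono-≤ (ℤ.+≤+ a≤b))) lo , ≤-trans hi (ι-mono-≤ (ℤ.+≤+ a≤b))

  bounded-resp : ∀ {x y b} → x ≈ y → Bounded x b → Bounded y b
  bounded-resp eq (lo , hi) = ≤-trans lo (≤-reflexive eq) , ≤-trans (≤-reflexive (sym eq)) hi

  bounded-0 : Bounded 0# 0
  bounded-0 = ≤-reflexive ι-0 , ≤-reflexive (sym ι-0)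

  bounded-+ : ∀ {x y a b} → Bounded x a → Bounded y b → Bounded (x + y) (a ℕ.+ b)
  bounded-+ {a = a} {b} (lo , hi) (lo′ , hi′) =
    ≤-trans (≤-reflexive (trans (reflexive (≡.cong ι (ℤ.neg-distrib-+ (+ a) (+ b)))) (ι-+ (ℤ.- + a) (ℤ.- + b)))) (+-mono-≤ lo lo′) ,
    ≤-trans (+-mono-≤ hi hi′) (≤-reflexive (sym (ι-+ (+ a) (+ b))))

  bounded-∃ : ∀ x → ∃[ b ] Bounded x b
  bounded-∃ x with approxFloor x
  ... | k , k≤x , x≤k+3 = ℤ.∣ k ∣ ℕ.+ 3 ,
    ≤-trans (ι-mono-≤ (ℤ.≤-trans (ℤ.neg-mono-≤ (ℤ.+≤+ (ℕ.m≤m+n ℤ.∣ k ∣ 3))) (-∣k∣≤k k))) k≤x ,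
    ≤-trans x≤k+3 (ι-mono-≤ (ℤ.+-monoˡ-≤ (+ 3) (k≤∣k∣ k)))
    where
    k≤∣k∣ : ∀ k → k ℤ.≤ + ℤ.∣ k ∣
    k≤∣k∣ (+ _)      = ℤ.≤-refl
    k≤∣k∣ ℤ.-[1+ _ ] = ℤ.-≤+
    -∣k∣≤k : ∀ k → ℤ.- + ℤ.∣ k ∣ ℤ.≤ k
    -∣k∣≤k (+ zero)   = ℤ.≤-refl
    -∣k∣≤k ℤ.+[1+ _ ] = ℤ.-≤+
    -∣k∣≤k ℤ.-[1+ _ ] = ℤ.≤-refl

  bounded-sum : ∀ {n b} (t : Fin n → Carrier) → (∀ j → Bounded (t j) b) → Bounded (sum t) (n ℕ.* b)
  bounded-sum {zero}  t h = bounded-0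
  bounded-sum {suc n} t h = bounded-+ (h Fin.zero) (bounded-sum (t ∘ Fin.suc) (h ∘ Fin.suc))

  ι-suc-* : ∀ u x → ι (+ suc u) * x ≈ x + ι (+ u) * x
  ι-suc-* u x = begin
    ι (+ suc u) * x            ≈⟨ *-congʳ (ι-+ (+ 1) (+ u)) ⟩
    (ι (+ 1) + ι (+ u)) * x    ≈⟨ distribʳ x _ _ ⟩
    ι (+ 1) * x + ι (+ u) * x  ≈⟨ +-congʳ (trans (*-congʳ ι-1) (*-identityˡ x)) ⟩
    x + ι (+ u) * x            ∎

  bounded-*ℕ : ∀ {x b} u → Bounded x b → Bounded (ι (+ u) * x) (u ℕ.* b)
  bounded-*ℕ {x} zero    h = bounded-resp (sym (trans (*-congʳ ι-0) (zeroˡ x))) bounded-0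
  bounded-*ℕ {x} (suc u) h = bounded-resp (sym (ι-suc-* u x)) (bounded-+ h (bounded-*ℕ u h))

  module _ {r s} (β : Fin r → Fin s → Carrier) (C : ℕ) (bounded : ∀ i j → Bounded (β i j) C) (B : ℕ)
           (few-boxes : (4 ℕ.+ 2 ℕ.* (s ℕ.* (B ℕ.* C))) ℕ.^ r ℕ.< suc B ℕ.^ s) where

    private
      V : ℕ
      V = s ℕ.* (B ℕ.* C)

      Digits : Set
      Digits = Fin s → Fin (suc B)

      value : Digits → Fin r → Carrier
      value a i = sum (λ j → ι (+ toℕ (a j)) * β i j)

      level : Digits → Fin r → ℤ
      level a i = proj₁ (approxFloor (value a i))

      value-bounded : ∀ a i → Bounded (value a i) V
      value-bounded a i = bounded-sum (λ j → ι (+ toℕ (a j)) * β i j) λ j →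
        bounded-mono (ℕ.*-monoˡ-≤ C (ℕ.≤-pred (Fin.toℕ<n (a j)))) (bounded-*ℕ (toℕ (a j)) (bounded i j))

      box : ∀ a i → Σ[ c ∈ Fin (4 ℕ.+ 2 ℕ.* V) ] + toℕ c ≡ level a i ℤ.+ + (3 ℕ.+ V)
      box a i = ≤-box V (level a i)
        (ι-cancel-≤ (≤-trans (proj₁ (value-bounded a i)) (proj₂ (proj₂ (approxFloor (value a i))))))
        (ι-cancel-≤ (≤-trans (proj₁ (proj₂ (approxFloor (value a i)))) (proj₂ (value-bounded a i))))

      term : ∀ x y z → ι (x ℤ.- y) * z + ι y * z ≈ ι x * z
      term x y z = begin
        ι (x ℤ.- y) * z + ι y * z   ≈⟨ distribʳ z _ _ ⟨
        (ι (x ℤ.- y) + ι y) * z     ≈⟨ *-congʳ (ι-+ (x ℤ.- y) y) ⟨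
        ι (x ℤ.- y ℤ.+ y) * z       ≡⟨ ≡.cong (λ k → ι k * z) (i-j+j x y) ⟩
        ι x * z                     ∎
        where
        i-j+j : ∀ i j → i ℤ.- j ℤ.+ j ≡ i
        i-j+j i j = ≡.trans (ℤ.+-assoc i (ℤ.- j) j) (≡.trans (≡.cong (λ k → i ℤ.+ k) (ℤ.+-inverseˡ j)) (ℤ.+-identityʳ i))

      -- Here `s` stands for p - q, where p and q have the same level k: s + k ≤ s + q = p ≤ k + 3,
      -- and k cancels. An upper bound is enough, because the inequalities it serves are one-sided.
      difference-small : ∀ k s p q → s + q ≈ p → ι k ≤ q → p ≤ ι (k ℤ.+ + 3) → s ≤ ι (+ 3)
      difference-small k s p q s+q≈p k≤q p≤k+3 =
        ≤-trans (≤-reflexive (sym (trans (+-congʳ (+-comm s (ι k))) (xyx⁻¹≈y (ι k) s))))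
          (≤-trans (+-mono-≤ step (≤-reflexive refl)) (≤-reflexive (xyx⁻¹≈y (ι k) (ι (+ 3)))))
        where
        step : s + ι k ≤ ι k + ι (+ 3)
        step = ≤-trans (+-mono-≤ (≤-reflexive refl) k≤q)
          (≤-trans (≤-reflexive s+q≈p) (≤-trans p≤k+3 (≤-reflexive (ι-+ k (+ 3)))))

    small-combination : Σ[ u ∈ (Fin s → ℤ) ]
      (¬ (∀ j → u j ≡ + 0) × (∀ i → sum (λ j → ι (u j) * β i j) ≤ ι (+ 3)))
    small-combination = let a , b , a≢b , same = pigeonhole-digits few-boxes (λ a i → proj₁ (box a i)) in
      (λ j → + toℕ (a j) ℤ.- + toℕ (b j)) ,
      (λ z → a≢b λ j → Fin.toℕ-injective (ℤ.+-injective (ℤ.i-j≡0⇒i≡j (+ toℕ (a j)) (+ toℕ (b j)) (z j)))) ,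
      λ i → difference-small (level a i) _ (value a i) (value b i)
        (trans (sym (∑-distrib-+ (λ j → ι (+ toℕ (a j) ℤ.- + toℕ (b j)) * β i j) (λ j → ι (+ toℕ (b j)) * β i j)))
          (sum-cong-≋ λ j → term (+ toℕ (a j)) (+ toℕ (b j)) (β i j)))
        (≡.subst (λ k → ι k ≤ value b i) (≡.sym (same-level a b i (same i))) (proj₁ (proj₂ (approxFloor (value b i)))))
        (proj₂ (proj₂ (approxFloor (value a i))))
      where
      same-level : ∀ a b i → proj₁ (box a i) ≡ proj₁ (box b i) → level a i ≡ level b i
      same-level a b i eq = ℤ-group.∙-cancelʳ (+ (3 ℕ.+ V)) _ _
        (≡.trans (≡.sym (proj₂ (box a i))) (≡.trans (≡.cong (λ c → + toℕ c) eq) (proj₂ (box b i))))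

  abstract
    -- The bound 3 is the width of one level and not small in itself. Smallness is obtained by
    -- scaling the rows of `β` beforehand, which only raises the entry bound and with it the number
    -- of digits.
    dirichlet : ∀ {r} (β : Fin r → Fin (suc r) → Carrier) → Σ[ u ∈ (Fin (suc r) → ℤ) ]
      (¬ (∀ j → u j ≡ + 0) × (∀ i → sum (λ j → ι (u j) * β i j) ≤ ι (+ 3)))
    dirichlet {r} β = let C , bounded = entries in small-combination β C bounded _ (few-boxes r C)
      where
      entries : ∃[ b ] ∀ i j → Bounded (β i j) b
      entries = finite-bound (λ i b → ∀ j → Bounded (β i j) b) (λ _ a≤b h j → bounded-mono a≤b (h j))
        λ i → finite-bound (λ j → Bounded (β i j)) (λ _ → bounded-mono) λ j → bounded-∃ (β i j)

-- Integer points

private module ℤ-Sum = Sums ℤ.+-*-semiring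
open ℤ-Sum using () renaming (sum to sumℤ)

-- Integer coefficients suffice, since the relation to be contradicted comes from `dirichlet`; their
-- vanishing is moreover decidable.
IntegrallyIndependent : ∀ {k m} → (Fin k → Fin m → ℤ) → Set
IntegrallyIndependent {k} ys =
  ∀ (u : Fin k → ℤ) → (∀ l → sumℤ (λ j → u j ℤ.* ys j l) ≡ + 0) → ∀ j → u j ≡ + 0

homogenize : ∀ {d} → Vec ℤ d → Fin (suc d) → ℤ
homogenize x = + 1 ∷ᶠ lookup x

sumℤ-differences : ∀ {k} (u y : Fin k → ℤ) c →
  ℤ.- sumℤ u ℤ.* c ℤ.+ sumℤ (λ j → u j ℤ.* y j) ≡ sumℤ (λ j → u j ℤ.* (y j ℤ.- c))
sumℤ-differences {zero}  u y c = ≡.refl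
sumℤ-differences {suc k} u y c = ≡.trans
  (lem (u Fin.zero) (sumℤ (u ∘ Fin.suc)) c (y Fin.zero) (sumℤ (λ j → u (Fin.suc j) ℤ.* y (Fin.suc j))))
  (≡.cong (λ s → u Fin.zero ℤ.* (y Fin.zero ℤ.- c) ℤ.+ s) (sumℤ-differences (u ∘ Fin.suc) (y ∘ Fin.suc) c))
  where
  lem : ∀ u s c y t → ℤ.- (u ℤ.+ s) ℤ.* c ℤ.+ (u ℤ.* y ℤ.+ t) ≡ u ℤ.* (y ℤ.- c) ℤ.+ (ℤ.- s ℤ.* c ℤ.+ t)
  lem = ℤ-solve-∀

sumℤ-zero : ∀ {k} (t : Fin k → ℤ) → (∀ j → t j ≡ + 0) → sumℤ t ≡ + 0
sumℤ-zero {k} t h = ≡.trans (ℤ-Sum.sum-cong-≗ h) (ℤ-Sum.sum-replicate-zero k)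

-- A relation Σ u_j (y_j - y₀) = 0 becomes a relation of the homogenized points once `y₀` receives
-- the coefficient -Σ u_j, which also balances the leading coordinate.
independent-differences : ∀ {d k} (y₀ : Vec ℤ d) (ys : Fin k → Vec ℤ d) →
  IntegrallyIndependent (homogenize y₀ ∷ᶠ (homogenize ∘ ys)) →
  IntegrallyIndependent (λ j l → lookup (ys j) l ℤ.- lookup y₀ l)
independent-differences y₀ ys ind u h j = ind ((ℤ.- sumℤ u) ∷ᶠ u)
  (λ { Fin.zero → ≡.trans (sumℤ-differences u (λ _ → + 1) (+ 1)) (sumℤ-zero _ λ j → ℤ.*-zeroʳ (u j))
     ; (Fin.suc l) → ≡.trans (sumℤ-differences u (λ j → lookup (ys j) l) (lookup y₀ l)) (h l) })
  (Fin.suc j)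

coordinate-bound : ∀ {d} (xs : List (Vec ℤ d)) → ∃[ M ] ∀ x → x ∈ₗ xs → ∀ l → ℤ.∣ lookup x l ∣ ℕ.≤ M
coordinate-bound []       = 0 , λ _ ()
coordinate-bound (x ∷ xs) with coordinate-bound xs
  | finite-bound (λ l b → ℤ.∣ lookup x l ∣ ℕ.≤ b) (λ _ a≤b h → ℕ.≤-trans h a≤b) (λ l → _ , ℕ.≤-refl)
... | M , h | N , k = M ℕ.⊔ N , λ
  { _ (here ≡.refl) l → ℕ.≤-trans (k l) (ℕ.m≤n⊔m M N)
  ; y (there y∈xs) l → ℕ.≤-trans (h y y∈xs l) (ℕ.m≤m⊔n M N) }

-- Two integers of modulus at most M differ by at most 2M, so a difference divisible by 2M + 1 is
-- zero.
small-multiple : ∀ M t x y → ℤ.∣ x ∣ ℕ.≤ M → ℤ.∣ y ∣ ℕ.≤ M → y ≡ x ℤ.+ + suc (2 ℕ.* M) ℤ.* t → t ≡ + 0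
small-multiple M t x y hx hy eq = ℤ.∣i∣≡0⇒i≡0 (ℕ.n<1⇒n≡0 (ℕ.*-cancelˡ-< (suc (2 ℕ.* M)) ℤ.∣ t ∣ 1 (begin-strict
  suc (2 ℕ.* M) ℕ.* ℤ.∣ t ∣         ≡⟨ ℤ.abs-* (+ suc (2 ℕ.* M)) t ⟨
  ℤ.∣ + suc (2 ℕ.* M) ℤ.* t ∣       ≡⟨ ≡.cong ℤ.∣_∣ (lem x (+ suc (2 ℕ.* M) ℤ.* t)) ⟩
  ℤ.∣ (x ℤ.+ + suc (2 ℕ.* M) ℤ.* t) ℤ.- x ∣   ≡⟨ ≡.cong (λ z → ℤ.∣ z ℤ.- x ∣) eq ⟨
  ℤ.∣ y ℤ.- x ∣                     ≤⟨ ℤ.∣i-j∣≤∣i∣+∣j∣ y x ⟩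
  ℤ.∣ y ∣ ℕ.+ ℤ.∣ x ∣               ≤⟨ ℕ.+-mono-≤ hy hx ⟩
  M ℕ.+ M                           ≡⟨ ≡.cong (M ℕ.+_) (ℕ.+-identityʳ M) ⟨
  2 ℕ.* M                           <⟨ ℕ.n<1+n _ ⟩
  suc (2 ℕ.* M)                     ≡⟨ ℕ.*-identityʳ _ ⟨
  suc (2 ℕ.* M) ℕ.* 1               ∎)))
  where
  open ℕ.≤-Reasoning
  lem : ∀ x s → s ≡ (x ℤ.+ s) ℤ.- x
  lem = ℤ-solve-∀

¬¬-Fin : ∀ {n} {P : Fin n → Set} → (∀ i → ¬ ¬ P i) → ¬ ¬ (∀ i → P i)
¬¬-Fin {zero}  h k = k λ ()
¬¬-Fin {suc n} h k = h Fin.zero λ p → ¬¬-Fin (h ∘ Fin.suc) λ q →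
  k λ { Fin.zero → p ; (Fin.suc i) → q i }

module LatticePoints (D : ArchimedeanDomain) where
  open ArchimedeanDomain D
  open Spans commutativeRing
  open Sums semiring
  open Dirichlet D
  open import Relation.Binary.Reasoning.Setoid setoid

  form : ∀ {d} → (Fin d → Carrier) → (Fin d → ℤ) → Carrier
  form a f = sum (λ l → a l * ι (f l))

  form-cong : ∀ {d} (a : Fin d → Carrier) {f g : Fin d → ℤ} → (∀ l → f l ≡ g l) → form a f ≈ form a g
  form-cong a h = sum-cong-≋ λ l → *-congˡ (reflexive (≡.cong ι (h l)))

  form-+ : ∀ {d} (a : Fin d → Carrier) f g → form a (λ l → f l ℤ.+ g l) ≈ form a f + form a g
  form-+ a f g = trans (sum-cong-≋ λ l → trans (*-congˡ (ι-+ (f l) (g l))) (distribˡ (a l) _ _))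
    (∑-distrib-+ (λ l → a l * ι (f l)) (λ l → a l * ι (g l)))

  form-* : ∀ {d} (a : Fin d → Carrier) c f → form a (λ l → c ℤ.* f l) ≈ ι c * form a f
  form-* a c f = trans
    (sum-cong-≋ λ l → trans (*-congˡ (ι-* c (f l)))
      (trans (sym (*-assoc (a l) (ι c) _)) (trans (*-congʳ (*-comm (a l) (ι c))) (*-assoc (ι c) (a l) _))))
    (sym (*-distribˡ-sum (ι c) (λ l → a l * ι (f l))))

  form-sum : ∀ {d k} (a : Fin d → Carrier) (u : Fin k → ℤ) (f : Fin k → Fin d → ℤ) →
    form a (λ l → sumℤ (λ j → u j ℤ.* f j l)) ≈ sum (λ j → ι (u j) * form a (f j))
  form-sum {k = zero}  a u f = sum-zero _ λ l → trans (*-congˡ ι-0) (zeroʳ (a l))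
  form-sum {k = suc k} a u f = trans
    (form-+ a (λ l → u Fin.zero ℤ.* f Fin.zero l) (λ l → sumℤ (λ j → u (Fin.suc j) ℤ.* f (Fin.suc j) l)))
    (+-cong (form-* a (u Fin.zero) (f Fin.zero)) (form-sum a (u ∘ Fin.suc) (f ∘ Fin.suc)))

  form-difference : ∀ {d} (a : Fin d → Carrier) f g → form a g + form a (λ l → f l ℤ.- g l) ≈ form a f
  form-difference a f g = trans (sym (form-+ a g (λ l → f l ℤ.- g l))) (form-cong a λ l → lem (f l) (g l))
    where
    lem : ∀ x y → y ℤ.+ (x ℤ.- y) ≡ x
    lem = ℤ-solve-∀

  module _ {d r m} {X : Vec ℤ d → Set} (xs : List (Vec ℤ d)) (X⊆xs : ∀ x → X x → x ∈ₗ xs)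
           (A : Fin r → Fin d → Carrier) (b : Fin r → Carrier)
           (U : Fin m → Fin d → Carrier) (v : Fin m → Carrier)
           (sound : ∀ x → X x → (∀ i → form (A i) (lookup x) ≤ b i) × (∀ i → form (U i) (lookup x) ≈ v i))
           (complete : ∀ x → (∀ i → form (A i) (lookup x) ≤ b i) → (∀ i → form (U i) (lookup x) ≈ v i) → X x)
           where

    Tight : Fin r → Vec ℤ d → Set
    Tight i x = form (A i) (lookup x) ≈ b i

    -- The displaced point starts at `y₀` and spends only the slack at `y₀`, whereas a row tight
    -- there is kept constant by being tight at every `ys j`. Hence the asymmetric condition on
    -- rows. As the conclusion is a negation, the doubly negated slacks of all rows may be collected
    -- first.
    class-bound : ∀ (y₀ : Vec ℤ d) (ys : Fin (suc r) → Vec ℤ d) → X y₀ → (∀ j → X (ys j)) →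
      (∀ i → (Tight i y₀ × (∀ j → Tight i (ys j))) ⊎ ¬ Tight i y₀) →
      ¬ IntegrallyIndependent (homogenize y₀ ∷ᶠ (homogenize ∘ ys))
    class-bound y₀ ys Xy₀ Xys pattern′ ind = ¬¬-Fin slack λ κ → absurd (proj₁ ∘ κ) (proj₂ ∘ κ)
      where
      Tight-row : Fin r → Set
      Tight-row i = Tight i y₀ × (∀ j → Tight i (ys j))
      Slack : Fin r → Carrier → Set
      Slack i κ = Tight-row i ⊎ (∀ v → κ * v ≤ ι (+ 3) → form (A i) (lookup y₀) + v ≤ b i)
      slack : ∀ i → ¬ ¬ (Σ[ κ ∈ Carrier ] Slack i κ)
      slack i k with pattern′ i
      -- A tight row is preserved exactly, so its multiplier is a mere default; its row in
      -- Dirichlet's matrix is zero.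
      ... | inj₁ t = k (0# , inj₁ t)
      ... | inj₂ s = ¬¬-slack (proj₁ (sound y₀ Xy₀) i) s λ (κ , h) → k (κ , inj₂ h)

      M = proj₁ (coordinate-bound xs)
      R : ℤ
      R = + suc (2 ℕ.* M)
      δ : Fin (suc r) → Fin d → ℤ
      δ j l = lookup (ys j) l ℤ.- lookup y₀ l

      absurd : (κ : Fin r → Carrier) → ¬ (∀ i → Slack i (κ i))
      -- The factor `ι R` puts the whole displacement, modulus included, under the bound 3, and
      -- `κ i` converts that bound into the slack of row i.
      absurd κ hκ with dirichlet (λ i j → κ i * (ι R * form (A i) (δ j)))
      ... | u , u≢0 , small = u≢0 (independent-differences y₀ ys ind u t≡0)
        where
        t : Fin d → ℤ
        t l = sumℤ (λ j → u j ℤ.* δ j l)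
        x : Vec ℤ d
        x = tabulate λ l → lookup y₀ l ℤ.+ R ℤ.* t l

        step : (Fin d → Carrier) → Carrier
        step a = ι R * sum (λ j → ι (u j) * form a (δ j))

        form-x : ∀ a → form a (lookup x) ≈ form a (lookup y₀) + step a
        form-x a = begin
          form a (lookup x)
            ≈⟨ form-cong a (lookup∘tabulate _) ⟩
          form a (λ l → lookup y₀ l ℤ.+ R ℤ.* t l)
            ≈⟨ form-+ a (lookup y₀) (λ l → R ℤ.* t l) ⟩
          form a (lookup y₀) + form a (λ l → R ℤ.* t l)
            ≈⟨ +-congˡ (trans (form-* a R t) (*-congˡ (form-sum a u δ))) ⟩
          form a (lookup y₀) + step a ∎

        constant : ∀ a c → form a (lookup y₀) ≈ c → (∀ j → form a (lookup (ys j)) ≈ c) → form a (lookup x) ≈ c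
        constant a c h₀ h = begin
          form a (lookup x)           ≈⟨ form-x a ⟩
          form a (lookup y₀) + step a ≈⟨ +-congˡ (trans (*-congˡ (sum-zero _ λ j → trans (*-congˡ (δ≈0 j)) (zeroʳ (ι (u j))))) (zeroʳ (ι R))) ⟩
          form a (lookup y₀) + 0#     ≈⟨ +-identityʳ _ ⟩
          form a (lookup y₀)          ≈⟨ h₀ ⟩
          c                           ∎
          where
          open import Algebra.Properties.Group +-group using (identityʳ-unique)
          δ≈0 : ∀ j → form a (δ j) ≈ 0#
          δ≈0 j = identityʳ-unique (form a (lookup y₀)) (form a (δ j))
            (trans (form-difference a (lookup (ys j)) (lookup y₀)) (trans (h j) (sym h₀)))

        scaled : ∀ i → κ i * step (A i) ≈ sum (λ j → ι (u j) * (κ i * (ι R * form (A i) (δ j))))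
        scaled i = begin
          κ i * (ι R * sum (λ j → ι (u j) * form (A i) (δ j)))
            ≈⟨ *-assoc (κ i) (ι R) _ ⟨
          κ i * ι R * sum (λ j → ι (u j) * form (A i) (δ j))
            ≈⟨ *-distribˡ-sum (κ i * ι R) (λ j → ι (u j) * form (A i) (δ j)) ⟩
          sum (λ j → κ i * ι R * (ι (u j) * form (A i) (δ j)))
            ≈⟨ sum-cong-≋ (λ j → trans (x∙yz≈y∙xz (κ i * ι R) (ι (u j)) (form (A i) (δ j)))
                 (*-congˡ (*-assoc (κ i) (ι R) (form (A i) (δ j))))) ⟩
          sum (λ j → ι (u j) * (κ i * (ι R * form (A i) (δ j)))) ∎
          where open import Algebra.Properties.CommutativeSemigroup *-commutativeSemigroup using (x∙yz≈y∙xz)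

        inequality : ∀ i → form (A i) (lookup x) ≤ b i
        inequality i with hκ i
        ... | inj₁ (h₀ , h) = ≤-reflexive (constant (A i) (b i) h₀ h)
        ... | inj₂ h = ≤-trans (≤-reflexive (form-x (A i)))
                (h (step (A i)) (≤-trans (≤-reflexive (scaled i)) (small i)))

        Xx : X x
        Xx = complete x inequality λ i → constant (U i) (v i) (proj₂ (sound y₀ Xy₀) i) (λ j → proj₂ (sound (ys j) (Xys j)) i)

        t≡0 : ∀ l → t l ≡ + 0
        t≡0 l = small-multiple M (t l) (lookup y₀ l) (lookup x l)
          (proj₂ (coordinate-bound xs) y₀ (X⊆xs y₀ Xy₀) l)
          (proj₂ (coordinate-bound xs) x (X⊆xs x Xx) l)
          (lookup∘tabulate _ l)

-- Covering by few independent points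

-- It is applied to tightness, an equality of reals, so each element costs one use of excluded
-- middle under double negation.
¬¬-partition : ∀ {A : Set} (P : A → Set) (ws : List A) →
  ¬ ¬ (Σ[ us ∈ List A ] Σ[ vs ∈ List A ]
    ((∀ x → x ∈ₗ us → x ∈ₗ ws × P x) × (∀ x → x ∈ₗ vs → x ∈ₗ ws × ¬ P x) ×
     (∀ x → x ∈ₗ ws → x ∈ₗ us ⊎ x ∈ₗ vs)))
¬¬-partition P []       k = k ([] , [] , (λ _ ()) , (λ _ ()) , λ _ ())
¬¬-partition P (w ∷ ws) k = ¬¬-partition P ws λ (us , vs , hu , hv , cover) → ¬¬-excluded-middle λ
  { (yes Pw) → k (w ∷ us , vs
      , (λ { x (here ≡.refl) → here ≡.refl , Pw ; x (there i) → there (proj₁ (hu x i)) , proj₂ (hu x i) })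
      , (λ x i → there (proj₁ (hv x i)) , proj₂ (hv x i))
      , λ { x (here eq) → inj₁ (here eq) ; x (there i) → case cover x i of λ { (inj₁ j) → inj₁ (there j) ; (inj₂ j) → inj₂ j } })
  ; (no ¬Pw) → k (us , w ∷ vs
      , (λ x i → there (proj₁ (hu x i)) , proj₂ (hu x i))
      , (λ { x (here ≡.refl) → here ≡.refl , ¬Pw ; x (there i) → there (proj₁ (hv x i)) , proj₂ (hv x i) })
      , λ { x (here eq) → inj₂ (here eq) ; x (there i) → case cover x i of λ { (inj₁ j) → inj₁ j ; (inj₂ j) → inj₂ (there j) } }) }

module Covering (D : ArchimedeanDomain) where
  open ArchimedeanDomain D
  open Spans commutativeRing
  open Kernel 1≉0 ≈0-stable noZeroDivisors
  open Sums semiring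
  open Dirichlet D
  open LatticePoints D
  open import Algebra.Properties.Ring ring using (-‿distribˡ-*; -‿distribʳ-*; -‿involutive; +-inverseʳ-unique)
  open import Relation.Binary.Reasoning.Setoid setoid

  ι-sum : ∀ {k} (t : Fin k → ℤ) → ι (sumℤ t) ≈ sum (ι ∘ t)
  ι-sum {zero}  t = ι-0
  ι-sum {suc k} t = trans (ι-+ (t Fin.zero) (sumℤ (t ∘ Fin.suc))) (+-congˡ (ι-sum (t ∘ Fin.suc)))

  ι-relation : ∀ {k m} (u : Fin k → ℤ) (ys : Fin k → Fin m → ℤ) l →
    sumℤ (λ j → u j ℤ.* ys j l) ≡ + 0 → sum (λ j → ι (u j) * ι (ys j l)) ≈ 0#
  ι-relation u ys l h = begin
    sum (λ j → ι (u j) * ι (ys j l))    ≈⟨ sum-cong-≋ (λ j → ι-* (u j) (ys j l)) ⟨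
    sum (λ j → ι (u j ℤ.* ys j l))      ≈⟨ ι-sum (λ j → u j ℤ.* ys j l) ⟨
    ι (sumℤ (λ j → u j ℤ.* ys j l))     ≡⟨ ≡.cong ι h ⟩
    ι (+ 0)                             ≈⟨ ι-0 ⟩
    0#                                  ∎

  point : ∀ {d} → Vec ℤ d → Fin (suc d) → Carrier
  point x = ι ∘ homogenize x

  -- Whether the coefficient of the new vector vanishes is decidable for an integer, and a nonzero
  -- integer is invertible in the domain; dividing by it would place the new vector in the span of
  -- the others.
  independent-∷ : ∀ {k m} {ys : Fin k → Fin m → ℤ} {x : Fin m → ℤ} → IntegrallyIndependent ys →
    ¬ InSpan (λ j → ι ∘ ys j) (ι ∘ x) → IntegrallyIndependent (x ∷ᶠ ys)
  independent-∷ {ys = ys} {x} ind x∉ u h with u Fin.zero ℤ.≟ + 0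
  ... | yes u₀≡0 = λ { Fin.zero → u₀≡0 ; (Fin.suc j) → ind (u ∘ Fin.suc) (λ l → ≡.trans
          (≡.sym (ℤ.+-identityˡ _)) (≡.trans (≡.cong (λ z → z ℤ.* x l ℤ.+ sumℤ (λ j → u (Fin.suc j) ℤ.* ys j l)) (≡.sym u₀≡0)) (h l))) j }
  ... | no u₀≢0 with ι-inverse (u Fin.zero) u₀≢0
  ...   | y , y*u₀≈1 = contradiction ((λ j → - y * ι (u (Fin.suc j))) , spans) x∉
    where
    spans : ∀ l → sum (λ j → - y * ι (u (Fin.suc j)) * ι (ys j l)) ≈ ι (x l)
    spans l = begin
      sum (λ j → - y * ι (u (Fin.suc j)) * ι (ys j l))
        ≈⟨ sum-cong-≋ (λ j → *-assoc (- y) (ι (u (Fin.suc j))) (ι (ys j l))) ⟩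
      sum (λ j → - y * (ι (u (Fin.suc j)) * ι (ys j l)))
        ≈⟨ *-distribˡ-sum (- y) (λ j → ι (u (Fin.suc j)) * ι (ys j l)) ⟨
      - y * sum (λ j → ι (u (Fin.suc j)) * ι (ys j l))
        ≈⟨ *-congˡ (+-inverseʳ-unique (ι (u Fin.zero) * ι (x l)) _ (ι-relation u (x ∷ᶠ ys) l (h l))) ⟩
      - y * - (ι (u Fin.zero) * ι (x l))
        ≈⟨ trans (sym (-‿distribˡ-* y _)) (trans (-‿cong (sym (-‿distribʳ-* y _))) (-‿involutive _)) ⟩
      y * (ι (u Fin.zero) * ι (x l))
        ≈⟨ *-assoc y _ _ ⟨
      y * ι (u Fin.zero) * ι (x l)
        ≈⟨ trans (*-congʳ y*u₀≈1) (*-identityˡ _) ⟩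
      ι (x l) ∎

  module _ {d r m} {X : Vec ℤ d → Set} (xs : List (Vec ℤ d)) (X⊆xs : ∀ x → X x → x ∈ₗ xs) (xs⊆X : ∀ x → x ∈ₗ xs → X x)
           (A : Fin r → Fin d → Carrier) (b : Fin r → Carrier)
           (U : Fin m → Fin d → Carrier) (v : Fin m → Carrier)
           (sound : ∀ x → X x → (∀ i → form (A i) (lookup x) ≤ b i) × (∀ i → form (U i) (lookup x) ≈ v i))
           (complete : ∀ x → (∀ i → form (A i) (lookup x) ≤ b i) → (∀ i → form (U i) (lookup x) ≈ v i) → X x)
           where

    IsTight : Fin r → Vec ℤ d → Set
    IsTight = Tight {X = X} xs X⊆xs A b U v sound complete

    Uniform : List (Vec ℤ d) → Fin r → Set
    Uniform ws i = (∀ x → x ∈ₗ ws → IsTight i x) ⊎ (∀ x → x ∈ₗ ws → ¬ IsTight i x)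

    SpanningIndependent : List (Vec ℤ d) → List (Vec ℤ d) → Set
    SpanningIndependent zs ws = Σ[ k ∈ ℕ ] Σ[ ys ∈ (Fin k → Vec ℤ d) ]
      (k ℕ.≤ suc r × (∀ j → ys j ∈ₗ zs) × IntegrallyIndependent (homogenize ∘ ys) ×
       (∀ x → x ∈ₗ ws → InSpan (point ∘ ys) (point x)))

    -- A point outside the current span is added to the family, which stays independent. Uniformity
    -- concerns the whole class `zs`, from which the family is drawn, while the recursion consumes
    -- the points `ws` still to be spanned.
    greedy : ∀ zs → (∀ x → x ∈ₗ zs → X x) → (∀ i → Uniform zs i) →
      ∀ ws → (∀ x → x ∈ₗ ws → x ∈ₗ zs) → ¬ ¬ SpanningIndependent zs ws
    greedy zs zs⊆X uniform []       ws⊆zs κ = κ (0 , (λ ()) , z≤n , (λ ()) , (λ _ _ ()) , λ _ ())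
    greedy zs zs⊆X uniform (w ∷ ws) ws⊆zs κ =
      greedy zs zs⊆X uniform ws (λ x i → ws⊆zs x (there i)) λ (k , ys , k≤ , ys∈ , ind , spans) →
      ¬¬-excluded-middle {A = InSpan (point ∘ ys) (point w)} λ
        { (yes w∈) → κ (k , ys , k≤ , ys∈ , ind , λ { x (here ≡.refl) → w∈ ; x (there i) → spans x i })
        ; (no w∉) → extend k ys k≤ ys∈ ind spans w∉ }
      where
      extend : ∀ k (ys : Fin k → Vec ℤ d) → k ℕ.≤ suc r → (∀ j → ys j ∈ₗ zs) →
        IntegrallyIndependent (homogenize ∘ ys) → (∀ x → x ∈ₗ ws → InSpan (point ∘ ys) (point x)) →
        ¬ ¬ InSpan (point ∘ ys) (point w)
      extend k ys k≤ ys∈ ind spans w∉ with ℕ.m≤n⇒m<n∨m≡n k≤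
      ... | inj₁ k< = κ (suc k , w ∷ᶠ ys , k< ,
              (λ { Fin.zero → ws⊆zs w (here ≡.refl) ; (Fin.suc j) → ys∈ j }) ,
              independent-∷ {ys = homogenize ∘ ys} {homogenize w} ind w∉ ,
              λ { x (here ≡.refl) → span-generator (point ∘ (w ∷ᶠ ys)) Fin.zero
                ; x (there i) → span-trans {g = point ∘ ys} {point ∘ (w ∷ᶠ ys)} (λ j → span-generator (point ∘ (w ∷ᶠ ys)) (Fin.suc j)) (spans x i) })
      -- With r + 1 points already chosen, `w` as base point would complete r + 2 independent points
      -- of one class.
      ... | inj₂ ≡.refl = class-bound {X = X} xs X⊆xs A b U v sound complete w ys
              (zs⊆X w (ws⊆zs w (here ≡.refl))) (λ j → zs⊆X (ys j) (ys∈ j)) pattern′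
              (independent-∷ {ys = homogenize ∘ ys} {homogenize w} ind w∉)
        where
        pattern′ : ∀ i → (IsTight i w × (∀ j → IsTight i (ys j))) ⊎ ¬ IsTight i w
        pattern′ i with uniform i
        ... | inj₁ t = inj₁ (t w (ws⊆zs w (here ≡.refl)) , λ j → t (ys j) (ys∈ j))
        ... | inj₂ s = inj₂ (s w (ws⊆zs w (here ≡.refl)))

    -- Independence is given up here: families of different classes are merely concatenated, and
    -- only their number and joint span count.
    SmallSpan : ℕ → List (Vec ℤ d) → Set
    SmallSpan N ws = Σ[ k ∈ ℕ ] Σ[ ys ∈ (Fin k → Vec ℤ d) ]
      (k ℕ.≤ N × (∀ x → x ∈ₗ ws → InSpan (point ∘ ys) (point x)))

    span-++ : ∀ {M N us vs ws} → (∀ x → x ∈ₗ ws → x ∈ₗ us ⊎ x ∈ₗ vs) →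
      SmallSpan M us → SmallSpan N vs → SmallSpan (M ℕ.+ N) ws
    span-++ split (k , ys , k≤ , h) (l , zs , l≤ , g) = k ℕ.+ l , ys ++ᶠ zs , ℕ.+-mono-≤ k≤ l≤ , λ x x∈ws →
      case split x x∈ws of λ
        { (inj₁ x∈us) → span-trans (λ j → ≡.subst (λ z → InSpan (point ∘ (ys ++ᶠ zs)) (point z))
            (lookup-++ˡ ys zs j) (span-generator (point ∘ (ys ++ᶠ zs)) (j ↑ˡ l))) (h x x∈us)
        ; (inj₂ x∈vs) → span-trans (λ j → ≡.subst (λ z → InSpan (point ∘ (ys ++ᶠ zs)) (point z))
            (lookup-++ʳ ys zs j) (span-generator (point ∘ (ys ++ᶠ zs)) (k ↑ʳ j))) (g x x∈vs) }

    -- Rows from k on are already uniform on `ws`. Splitting by the tightness of one more row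
    -- doubles the number of classes, and at k = 0 a whole class is left to `greedy`.
    cover : ∀ k → k ℕ.≤ r → ∀ ws → (∀ x → x ∈ₗ ws → X x) →
      (∀ i → k ℕ.≤ toℕ i → Uniform ws i) → ¬ ¬ SmallSpan (suc r ℕ.* 2 ℕ.^ k) ws
    cover zero _ ws ws⊆X uniform κ = greedy ws ws⊆X (λ i → uniform i z≤n) ws (λ _ x∈ws → x∈ws)
      λ (k , ys , k≤ , _ , _ , spans) → κ (k , ys , ℕ.≤-trans k≤ (ℕ.≤-reflexive (≡.sym (ℕ.*-identityʳ (suc r)))) , spans)
    cover (suc k) k<r ws ws⊆X uniform κ = ¬¬-partition (IsTight row) ws λ (us , vs , hu , hv , split) →
      cover k (ℕ.<⇒≤ k<r) us (λ x i → ws⊆X x (proj₁ (hu x i)))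
        (refine us (λ x i → proj₁ (hu x i)) (inj₁ λ x i → proj₂ (hu x i))) λ su →
      cover k (ℕ.<⇒≤ k<r) vs (λ x i → ws⊆X x (proj₁ (hv x i)))
        (refine vs (λ x i → proj₁ (hv x i)) (inj₂ λ x i → proj₂ (hv x i))) λ sv →
      κ (≡.subst (λ N → SmallSpan N ws) (double (suc r) (2 ℕ.^ k)) (span-++ split su sv))
      where
      row : Fin r
      row = fromℕ< k<r
      double : ∀ a b → a ℕ.* b ℕ.+ a ℕ.* b ≡ a ℕ.* (2 ℕ.* b)
      double a b = ≡.trans (≡.sym (ℕ.*-distribˡ-+ a b b)) (≡.cong (λ c → a ℕ.* (b ℕ.+ c)) (≡.sym (ℕ.+-identityʳ b)))
      refine : ∀ us → (∀ x → x ∈ₗ us → x ∈ₗ ws) → Uniform us row → ∀ i → k ℕ.≤ toℕ i → Uniform us i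
      refine us us⊆ws at-row i k≤i with ℕ.m≤n⇒m<n∨m≡n k≤i
      ... | inj₂ k≡i = ≡.subst (Uniform us) (Fin.toℕ-injective (≡.trans (Fin.toℕ-fromℕ< k<r) k≡i)) at-row
      ... | inj₁ k<i with uniform i k<i
      ...   | inj₁ t = inj₁ λ x x∈us → t x (us⊆ws x x∈us)
      ...   | inj₂ s = inj₂ λ x x∈us → s x (us⊆ws x x∈us)

    -- Homogenized, the points `p j` of the affine hull lie in the linear span of the covering
    -- points. If they outnumbered these they would be linearly dependent, and the leading
    -- coordinate makes that dependence affine.
    dimension-bound : ∀ {n} (p : Fin n → Fin d → Carrier) →
      (∀ c → sum c ≈ 0# → (∀ l → sum (λ j → c j * p j l) ≈ 0#) → ∀ j → c j ≈ 0#) →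
      (∀ j → Σ[ k ∈ ℕ ] Σ[ c ∈ (Fin k → Carrier) ] Σ[ q ∈ (Fin k → Fin d → Carrier) ]
        ((∀ i → Σ[ x ∈ Vec ℤ d ] (X x × (∀ l → q i l ≈ ι (lookup x l)))) ×
         sum c ≈ 1# × (∀ l → sum (λ i → c i * q i l) ≈ p j l))) →
      n ℕ.≤ suc r ℕ.* 2 ℕ.^ r
    dimension-bound p ind aff = ℕ.≮⇒≥ λ lt → cover r ℕ.≤-refl xs xs⊆X
      (λ i r≤i → contradiction (Fin.toℕ<n i) (ℕ.≤⇒≯ r≤i)) λ (k , ys , k≤ , spans) →
      span-dependent {g = λ j → 1# ∷ᶠ p j} {point ∘ ys} (ℕ.≤-<-trans k≤ lt) (λ j → p-span ys spans j) λ (w , eq , w≉0) →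
      w≉0 (ind w (trans (sum-cong-≋ λ j → sym (*-identityʳ (w j))) (eq Fin.zero)) (λ l → eq (Fin.suc l)))
      where
      p-span : ∀ {k} (ys : Fin k → Vec ℤ d) → (∀ x → x ∈ₗ xs → InSpan (point ∘ ys) (point x)) →
        ∀ j → InSpan (point ∘ ys) (1# ∷ᶠ p j)
      p-span ys spans j with aff j
      ... | l , c , q , q∈X , c≈1 , comb = span-trans {g = λ i → 1# ∷ᶠ q i}
        (λ i → let x , Xx , q≈x = q∈X i ; e , h = spans x (X⊆xs x Xx) in
          e , λ { Fin.zero → trans (h Fin.zero) ι-1 ; (Fin.suc l) → trans (h (Fin.suc l)) (sym (q≈x l)) })
        (c , λ { Fin.zero → trans (sum-cong-≋ λ i → *-identityʳ (c i)) c≈1 ; (Fin.suc l) → comb l })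

  -- The embedding E is kept as a variable so that, for Cauchy sequences of
  -- rationals, terms mentioning it are compared without being unfolded.
  embedded-dimension-bound : ∀ {d r m n} (E : Vec ℤ d → Fin d → Carrier) → (∀ x l → E x l ≈ ι (lookup x l)) →
    (X : Vec ℤ d → Set) (xs : List (Vec ℤ d)) → (∀ x → X x → x ∈ₗ xs) → (∀ x → x ∈ₗ xs → X x) →
    (A : Fin r → Fin d → Carrier) (b : Fin r → Carrier) (U : Fin m → Fin d → Carrier) (v : Fin m → Carrier) →
    (∀ x → X x → (∀ i → sum (λ l → A i l * E x l) ≤ b i) × (∀ i → sum (λ l → U i l * E x l) ≈ v i)) →
    (∀ x → (∀ i → sum (λ l → A i l * E x l) ≤ b i) → (∀ i → sum (λ l → U i l * E x l) ≈ v i) → X x) →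
    (p : Fin n → Fin d → Carrier) →
    (∀ c → sum c ≈ 0# → (∀ l → sum (λ j → c j * p j l) ≈ 0#) → ∀ j → c j ≈ 0#) →
    (∀ j → Σ[ k ∈ ℕ ] Σ[ c ∈ (Fin k → Carrier) ] Σ[ q ∈ (Fin k → Fin d → Carrier) ]
      ((∀ i → Σ[ x ∈ Vec ℤ d ] (X x × (∀ l → q i l ≈ E x l))) ×
       sum c ≈ 1# × (∀ l → sum (λ i → c i * q i l) ≈ p j l))) →
    n ℕ.≤ suc r ℕ.* 2 ℕ.^ r
  embedded-dimension-bound E E≈ι X xs X⊆xs xs⊆X A b U v sound complete p ind aff =
    dimension-bound {X = X} xs X⊆xs xs⊆X A b U v
      (λ x Xx → (λ i → ≤-trans (≤-reflexive (sym (form≈ (A i) x))) (proj₁ (sound x Xx) i)) ,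
                (λ i → trans (sym (form≈ (U i) x)) (proj₂ (sound x Xx) i)))
      (λ x hA hU → complete x (λ i → ≤-trans (≤-reflexive (form≈ (A i) x)) (hA i)) (λ i → trans (form≈ (U i) x) (hU i)))
      p ind λ j → let k , c , q , q∈X , rest = aff j in
        k , c , q , (λ i → let x , Xx , eq = q∈X i in x , Xx , λ l → trans (eq l) (E≈ι x l)) , rest
    where
    form≈ : ∀ a x → sum (λ l → a l * E x l) ≈ form a (lookup x)
    form≈ a x = sum-cong-≋ λ l → *-congˡ (E≈ι x l)

open import Defs
open import Data.Integer.DivMod using ([n/ℕd]*d≤n; n<s[n/ℕd]*d)
import Data.Nat.Coprimality as Coprime
open import Data.Nat.DivMod using (m≡m%n+[m/n]*n; m%n<n; m*n/n≡m; /-monoˡ-≤)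
open import Data.Nat.Logarithm using (⌊log₂_⌋; ⌊log₂⌋-mono-≤; ⌊log₂[2^n]⌋≡n)
open import Data.Rational.Base as ℚ using (ℚ; mkℚ; 0ℚ; 1ℚ; ½; ∣_∣; _/_; toℚᵘ)
import Data.Rational.Properties as ℚ
open import Data.Rational.Solver using (module +-*-Solver)
open import Data.Rational.Unnormalised.Base as ℚᵘ using (mkℚᵘ)
import Data.Rational.Unnormalised.Properties as ℚᵘ
open import Relation.Binary.PropositionalEquality
  using (refl; sym; trans; cong; cong₂; subst; subst₂)
open import Relation.Unary using (Pred; _∈_)

-- Real numbers as a commutative ring

≈-pointwise : ∀ {x y} → (∀ n → seq x n ≡ seq y n) → x ≈ y
≈-pointwise {x} {y} eq ε 0<ε = 0 , λ n _ →
  subst (λ p → ∣ p ∣ ℚ.< ε)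
    (sym (trans (cong (ℚ._- seq y n) (eq n)) (ℚ.+-inverseʳ (seq y n)))) 0<ε

≈-refl : ∀ {x} → x ≈ x
≈-refl {x} = ≈-pointwise {x} {x} (λ _ → refl)

≈-sym : ∀ {x y} → x ≈ y → y ≈ x
≈-sym {x} {y} x≈y ε 0<ε with x≈y ε 0<ε
... | N , h = N , λ n N≤n → subst (ℚ._< ε) (∣p-q∣-comm (seq x n) (seq y n)) (h n N≤n)

eventually₂ : ∀ {P Q R : ℕ → Set} → (∀ n → P n → Q n → R n) →
  (∃[ N ] ∀ n → N ℕ.≤ n → P n) → (∃[ N ] ∀ n → N ℕ.≤ n → Q n) →
  ∃[ N ] ∀ n → N ℕ.≤ n → R n
eventually₂ f (M , p) (N , q) = M ℕ.⊔ N , λ n le →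
  f n (p n (ℕ.m⊔n≤o⇒m≤o M N le)) (q n (ℕ.m⊔n≤o⇒n≤o M N le))

∣sum∣<ε : ∀ {p q r ε} → r ≡ p ℚ.+ q → ∣ p ∣ ℚ.< ½ ℚ.* ε → ∣ q ∣ ℚ.< ½ ℚ.* ε → ∣ r ∣ ℚ.< ε
∣sum∣<ε {p} {q} {r} {ε} eq hp hq =
  subst (∣ r ∣ ℚ.<_) (halves ε) (ℚ.≤-<-trans (triangle p q eq) (ℚ.+-mono-< hp hq))

≈-trans : ∀ {x y z} → x ≈ y → y ≈ z → x ≈ z
≈-trans {x} {y} {z} x≈y y≈z ε 0<ε = eventually₂
  (λ n → ∣sum∣<ε (lem (seq x n) (seq y n) (seq z n)))
  (x≈y (½ ℚ.* ε) (0<½*ε 0<ε)) (y≈z (½ ℚ.* ε) (0<½*ε 0<ε))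
  where
  open +-*-Solver
  lem : ∀ a b c → a ℚ.- c ≡ (a ℚ.- b) ℚ.+ (b ℚ.- c)
  lem = solve 3 (λ a b c → a :- c := (a :- b) :+ (b :- c)) refl

+-cong : ∀ {x y u v} → x ≈ y → u ≈ v → x + u ≈ y + v
+-cong {x} {y} {u} {v} x≈y u≈v ε 0<ε = eventually₂
  (λ n → ∣sum∣<ε (lem (seq x n) (seq y n) (seq u n) (seq v n)))
  (x≈y (½ ℚ.* ε) (0<½*ε 0<ε)) (u≈v (½ ℚ.* ε) (0<½*ε 0<ε))
  where
  open +-*-Solver
  lem : ∀ a b c d → (a ℚ.+ c) ℚ.- (b ℚ.+ d) ≡ (a ℚ.- b) ℚ.+ (c ℚ.- d)
  lem = solve 4 (λ a b c d → (a :+ c) :- (b :+ d) := (a :- b) :+ (c :- d)) refl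

-‿cong : ∀ {x y} → x ≈ y → - x ≈ - y
-‿cong {x} {y} x≈y ε 0<ε with x≈y ε 0<ε
... | N , h = N , λ n N≤n → subst (ℚ._< ε)
  (trans (∣p-q∣-comm (seq x n) (seq y n)) (cong ∣_∣ (lem (seq x n) (seq y n)))) (h n N≤n)
  where
  open +-*-Solver
  lem : ∀ a b → b ℚ.- a ≡ (ℚ.- a) ℚ.- (ℚ.- b)
  lem = solve 2 (λ a b → b :- a := (:- a) :- (:- b)) refl

*-comm : ∀ x y → x * y ≈ y * x
*-comm x y = ≈-pointwise {x * y} {y * x} (λ n → ℚ.*-comm (seq x n) (seq y n))

*-congˡ : ∀ {x y} z → x ≈ y → z * x ≈ z * y
*-congˡ {x} {y} z x≈y ε 0<ε =
  let B , 0<B , N , hB = bounded z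
      δ , 0<δ , eq = quotient 0<ε 0<B
  in eventually₂
       (λ n zₙ≤B d → subst (λ p → ∣ p ∣ ℚ.< ε) (lem (seq z n) (seq x n) (seq y n))
          (∣pq∣<ε {seq z n} {seq x n ℚ.- seq y n} 0<B eq zₙ≤B d))
       (N , hB) (x≈y δ 0<δ)
  where
  open +-*-Solver
  lem : ∀ a b c → a ℚ.* (b ℚ.- c) ≡ a ℚ.* b ℚ.- a ℚ.* c
  lem = solve 3 (λ a b c → a :* (b :- c) := a :* b :- a :* c) refl

*-cong : ∀ {x y u v} → x ≈ y → u ≈ v → x * u ≈ y * v
*-cong {x} {y} {u} {v} x≈y u≈v =
  ≈-trans {x * u} {x * v} {y * v} (*-congˡ {u} {v} x u≈v)
    (≈-trans {x * v} {v * x} {y * v} (*-comm x v)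
      (≈-trans {v * x} {v * y} {y * v} (*-congˡ {x} {y} v x≈y) (*-comm v y)))

ℝ-commutativeRing : CommutativeRing 0ℓ 0ℓ
ℝ-commutativeRing = record
  { Carrier = ℝ ; _≈_ = _≈_ ; _+_ = _+_ ; _*_ = _*_ ; -_ = -_ ; 0# = 0ℝ ; 1# = 1ℝ
  ; isCommutativeRing = record
    { isRing = record
      { +-isAbelianGroup = record
        { isGroup = record
          { isMonoid = record
            { isSemigroup = record
              { isMagma = record
                { isEquivalence = record
                  { refl  = λ {x} → ≈-refl {x}
                  ; sym   = λ {x} {y} → ≈-sym {x} {y}
                  ; trans = λ {x} {y} {z} → ≈-trans {x} {y} {z} }
                ; ∙-cong = λ {x} {y} {u} {v} → +-cong {x} {y} {u} {v} }
              ; assoc = λ x y z → ≈-pointwise {(x + y) + z} {x + (y + z)}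
                  λ n → ℚ.+-assoc (seq x n) (seq y n) (seq z n) }
            ; identity = (λ x → ≈-pointwise {0ℝ + x} {x} λ n → ℚ.+-identityˡ (seq x n))
                       , (λ x → ≈-pointwise {x + 0ℝ} {x} λ n → ℚ.+-identityʳ (seq x n)) }
          ; inverse = (λ x → ≈-pointwise {(- x) + x} {0ℝ} λ n → ℚ.+-inverseˡ (seq x n))
                    , (λ x → ≈-pointwise {x + (- x)} {0ℝ} λ n → ℚ.+-inverseʳ (seq x n))
          ; ⁻¹-cong = λ {x} {y} → -‿cong {x} {y} }
        ; comm = λ x y → ≈-pointwise {x + y} {y + x} λ n → ℚ.+-comm (seq x n) (seq y n) }
      ; *-cong = λ {x} {y} {u} {v} → *-cong {x} {y} {u} {v}
      ; *-assoc = λ x y z → ≈-pointwise {(x * y) * z} {x * (y * z)}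
          λ n → ℚ.*-assoc (seq x n) (seq y n) (seq z n)
      ; *-identity = (λ x → ≈-pointwise {1ℝ * x} {x} λ n → ℚ.*-identityˡ (seq x n))
                   , (λ x → ≈-pointwise {x * 1ℝ} {x} λ n → ℚ.*-identityʳ (seq x n))
      ; distrib = (λ x y z → ≈-pointwise {x * (y + z)} {x * y + x * z}
                     λ n → ℚ.*-distribˡ-+ (seq x n) (seq y n) (seq z n))
                , (λ x y z → ≈-pointwise {(y + z) * x} {y * x + z * x}
                     λ n → ℚ.*-distribʳ-+ (seq x n) (seq y n) (seq z n)) }
    ; *-comm = *-comm } }

fromℚ-cong : ∀ {p q} → p ≡ q → fromℚ p ≈ fromℚ q
fromℚ-cong {p} refl = ≈-refl {fromℚ p}

-- Apartness from zero

-- The positive form of being nonzero: it carries an explicit lower bound, which ¬ x ≈ 0 yields only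
-- under double negation.
#0 : ℝ → Set
#0 x = ∃[ c ] (0ℚ ℚ.< c × ∃[ N ] ∀ n → N ℕ.≤ n → c ℚ.≤ ∣ seq x n ∣)

-- With δ = ε / 4, a Cauchy sequence whose value at a late index is at least 2δ
-- in modulus stays above δ, and otherwise it stays below 3δ.
small⊎#0 : ∀ x ε → 0ℚ ℚ.< ε →
  (∃[ N ] ∀ n → N ℕ.≤ n → ∣ seq x n ∣ ℚ.< ε) ⊎ #0 x
small⊎#0 x ε 0<ε with cauchy x (½ ℚ.* (½ ℚ.* ε)) (0<½*ε (0<½*ε 0<ε))
... | N , h with ∣ seq x N ∣ ℚ.<? ½ ℚ.* ε
... | yes lt = inj₁ (N , λ n N≤n → ∣sum∣<ε {seq x N} {seq x n ℚ.- seq x N} {ε = ε}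
        (lem (seq x n) (seq x N)) lt (ℚ.<-trans (h n N N≤n ℕ.≤-refl) quarter))
  where
  open +-*-Solver
  lem : ∀ a b → a ≡ b ℚ.+ (a ℚ.- b)
  lem = solve 2 (λ a b → a := b :+ (a :- b)) refl
  quarter : ½ ℚ.* (½ ℚ.* ε) ℚ.< ½ ℚ.* ε
  quarter = subst₂ ℚ._<_ (ℚ.+-identityʳ _) (halves (½ ℚ.* ε))
    (ℚ.+-monoʳ-< (½ ℚ.* (½ ℚ.* ε)) (0<½*ε (0<½*ε 0<ε)))
... | no ≮ = inj₂ (δ , 0<½*ε (0<½*ε 0<ε) , N , λ n N≤n →
        ℚ.≮⇒≥ λ lt → ≮ (∣sum∣<ε {seq x n} {seq x N ℚ.- seq x n} (lem (seq x n) (seq x N))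
          lt (h N n ℕ.≤-refl N≤n)))
  where
  δ = ½ ℚ.* (½ ℚ.* ε)
  open +-*-Solver
  lem : ∀ a b → b ≡ a ℚ.+ (b ℚ.- a)
  lem = solve 2 (λ a b → b := a :+ (b :- a)) refl

p-0≡p : ∀ p → p ℚ.- 0ℚ ≡ p
p-0≡p = ℚ.+-identityʳ

-- For each ε the sequence is eventually below ε or apart from zero, so excluding apartness forces
-- convergence to zero. Equality with zero is thereby a negation, hence stable.
¬#0⇒≈0 : ∀ x → ¬ #0 x → x ≈ 0ℝ
¬#0⇒≈0 x ¬#0 ε 0<ε with small⊎#0 x ε 0<ε
... | inj₁ (N , h) = N , λ n N≤n → subst (λ p → ∣ p ∣ ℚ.< ε) (sym (p-0≡p (seq x n))) (h n N≤n)
... | inj₂ a = contradiction a ¬#0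

#0⇒≉0 : ∀ x → #0 x → ¬ x ≈ 0ℝ
#0⇒≉0 x (c , 0<c , N , h) x≈0 with x≈0 c 0<c
... | M , k = ℚ.<-irrefl refl (ℚ.≤-<-trans
  (h (N ℕ.⊔ M) (ℕ.m≤m⊔n N M))
  (subst (λ p → ∣ p ∣ ℚ.< c) (p-0≡p (seq x (N ℕ.⊔ M))) (k (N ℕ.⊔ M) (ℕ.m≤n⊔m N M))))

≉0⇒¬¬#0 : ∀ x → ¬ x ≈ 0ℝ → ¬ ¬ #0 x
≉0⇒¬¬#0 x x≉0 ¬a = x≉0 (¬#0⇒≈0 x ¬a)

≈0-stable : ∀ x → ¬ ¬ x ≈ 0ℝ → x ≈ 0ℝ
≈0-stable x ¬¬x≈0 = ¬#0⇒≈0 x λ a → ¬¬x≈0 (#0⇒≉0 x a)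

#0-* : ∀ x y → #0 x → #0 y → #0 (x * y)
#0-* x y (c , 0<c , p) (d , 0<d , q) = c ℚ.* d ,
  ℚ.positive⁻¹ (c ℚ.* d) {{ℚ.pos*pos⇒pos c {{ℚ.positive 0<c}} d {{ℚ.positive 0<d}}}} ,
  eventually₂ (λ n hc hd → subst (c ℚ.* d ℚ.≤_) (sym (ℚ.∣p*q∣≡∣p∣*∣q∣ (seq x n) (seq y n)))
    (ℚ.≤-trans (ℚ.*-monoʳ-≤-nonNeg d {{ℚ.nonNegative (ℚ.<⇒≤ 0<d)}} hc)
               (ℚ.*-monoˡ-≤-nonNeg ∣ seq x n ∣ {{ℚ.∣-∣-nonNeg (seq x n)}} hd))) p q

-- It is enough to refute apartness of y, and for a refutation the doubly negated apartness of x may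
-- be used.
ℝ-noZeroDivisors : ∀ x y → x * y ≈ 0ℝ → ¬ x ≈ 0ℝ → y ≈ 0ℝ
ℝ-noZeroDivisors x y xy≈0 x≉0 = ¬#0⇒≈0 y λ y#0 →
  ≉0⇒¬¬#0 x x≉0 λ x#0 → #0⇒≉0 (x * y) (#0-* x y x#0 y#0) xy≈0

-- Order

≤-trans : ∀ {x y z} → x ≤ y → y ≤ z → x ≤ z
≤-trans {x} {y} {z} x≤y y≤z ε 0<ε = eventually₂
  (λ n p q → ℚ.<-trans p (subst (seq y n ℚ.+ ½ ℚ.* ε ℚ.<_) (lem n) (ℚ.+-monoˡ-< (½ ℚ.* ε) q)))
  (x≤y (½ ℚ.* ε) (0<½*ε 0<ε)) (y≤z (½ ℚ.* ε) (0<½*ε 0<ε))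
  where
  lem : ∀ n → (seq z n ℚ.+ ½ ℚ.* ε) ℚ.+ ½ ℚ.* ε ≡ seq z n ℚ.+ ε
  lem n = trans (ℚ.+-assoc (seq z n) _ _) (cong (seq z n ℚ.+_) (halves ε))

≤-reflexive : ∀ {x y} → x ≈ y → x ≤ y
≤-reflexive {x} {y} x≈y ε 0<ε with x≈y ε 0<ε
... | N , h = N , λ n N≤n → ∣p-q∣<ε⇒p<q+ε {seq x n} {seq y n} (h n N≤n)

fromℚ-mono-≤ : ∀ {p q} → p ℚ.≤ q → fromℚ p ≤ fromℚ q
fromℚ-mono-≤ {p} {q} p≤q ε 0<ε = 0 , λ _ _ →
  subst (ℚ._< q ℚ.+ ε) (ℚ.+-identityʳ p) (ℚ.+-mono-≤-< p≤q 0<ε)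

fromℚ-cancel-≤ : ∀ {p q} → fromℚ p ≤ fromℚ q → p ℚ.≤ q
fromℚ-cancel-≤ {p} {q} h = ℚ.≮⇒≥ λ q<p →
  let N , k = h (p ℚ.- q) (subst (ℚ._< p ℚ.- q) (ℚ.+-inverseʳ q) (ℚ.+-monoˡ-< (ℚ.- q) q<p))
  in ℚ.<-irrefl (lem p q) (k N ℕ.≤-refl)
  where
  open +-*-Solver
  lem : ∀ p q → p ≡ q ℚ.+ (p ℚ.- q)
  lem = solve 2 (λ p q → p := q :+ (p :- q)) refl

+-mono-≤ : ∀ {x y u v} → x ≤ y → u ≤ v → x + u ≤ y + v
+-mono-≤ {x} {y} {u} {v} x≤y u≤v ε 0<ε = eventually₂
  (λ n p q → subst (seq x n ℚ.+ seq u n ℚ.<_)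
     (trans (lem (seq y n) (seq v n) (½ ℚ.* ε)) (cong (seq y n ℚ.+ seq v n ℚ.+_) (halves ε)))
     (ℚ.+-mono-< p q))
  (x≤y (½ ℚ.* ε) (0<½*ε 0<ε)) (u≤v (½ ℚ.* ε) (0<½*ε 0<ε))
  where
  open +-*-Solver
  lem : ∀ a b e → (a ℚ.+ e) ℚ.+ (b ℚ.+ e) ≡ (a ℚ.+ b) ℚ.+ (e ℚ.+ e)
  lem = solve 3 (λ a b e → (a :+ e) :+ (b :+ e) := (a :+ b) :+ (e :+ e)) refl

fromℚ-cancelˡ-≤ : ∀ {κ x y} → 0ℚ ℚ.< κ → fromℚ κ * x ≤ fromℚ κ * y → x ≤ y
fromℚ-cancelˡ-≤ {κ} {x} {y} 0<κ h ε 0<ε with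
  h (κ ℚ.* ε) (subst (ℚ._< κ ℚ.* ε) (ℚ.*-zeroʳ κ) (ℚ.*-monoʳ-<-pos κ {{ℚ.positive 0<κ}} 0<ε))
... | N , k = N , λ n N≤n → ℚ.*-cancelˡ-<-nonNeg κ {{ℚ.nonNegative (ℚ.<⇒≤ 0<κ)}}
  (subst (κ ℚ.* seq x n ℚ.<_) (sym (ℚ.*-distribˡ-+ κ (seq y n) ε)) (k n N≤n))

<⇒gap : ∀ {x y} → x < y → ∃[ ε ] (0ℚ ℚ.< ε × x + fromℚ ε ≤ y)
<⇒gap {x} {y} (ε , 0<ε , N , h) = ε , 0<ε , λ δ 0<δ → N , λ n N≤n →
  subst (ℚ._< seq y n ℚ.+ δ) (ℚ.+-identityʳ _) (ℚ.+-mono-≤-< (h n N≤n) 0<δ)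

-- If |x - y| ≥ c eventually, then x < y + c rules out the positive sign and leaves x + c ≤ y.
≤∧≉⇒¬¬< : ∀ {x y} → x ≤ y → ¬ x ≈ y → ¬ ¬ x < y
≤∧≉⇒¬¬< {x} {y} x≤y x≉y ¬x<y = x≉y (≈-diff λ ε 0<ε → ¬#0⇒≈0 (x - y) ¬d#0 ε 0<ε)
  where
  ≈-diff : x - y ≈ 0ℝ → x ≈ y
  ≈-diff d ε 0<ε with d ε 0<ε
  ... | N , h = N , λ n N≤n → subst (λ p → ∣ p ∣ ℚ.< ε) (p-0≡p (seq x n ℚ.- seq y n)) (h n N≤n)
  ¬d#0 : ¬ #0 (x - y)
  ¬d#0 (c , 0<c , p) = ¬x<y (c , 0<c , eventually₂ (λ n → gap (seq x n) (seq y n)) p (x≤y c 0<c))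
    where
    open +-*-Solver
    lem₁ : ∀ a b → a ℚ.+ (ℚ.- (a ℚ.- b)) ≡ b
    lem₁ = solve 2 (λ a b → a :+ (:- (a :- b)) := b) refl
    gap : ∀ a b → c ℚ.≤ ∣ a ℚ.- b ∣ → a ℚ.< b ℚ.+ c → a ℚ.+ c ℚ.≤ b
    gap a b c≤ a<b+c with ℚ.∣p∣≡p∨∣p∣≡-p (a ℚ.- b)
    ... | inj₁ eq = contradiction
          (ℚ.<-≤-trans (p<q+ε⇒p-q<ε {a} {b} a<b+c) (subst (c ℚ.≤_) eq c≤)) (ℚ.<-irrefl refl)
    ... | inj₂ eq = subst (a ℚ.+ c ℚ.≤_) (lem₁ a b) (ℚ.+-monoʳ-≤ a (subst (c ℚ.≤_) eq c≤))

-- Integers inside ℚ and ℝ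

/1-+ : ∀ i j → (i ℤ.+ j) / 1 ≡ i / 1 ℚ.+ j / 1
/1-+ i j = ℚ.toℚᵘ-injective
  (ℚᵘ.≃-trans (toℚᵘ-/ (i ℤ.+ j) 0)
  (ℚᵘ.≃-trans (ℚᵘ.*≡* (cong (ℤ._* + 1) (cong₂ ℤ._+_ (sym (ℤ.*-identityʳ i)) (sym (ℤ.*-identityʳ j)))))
  (ℚᵘ.≃-trans (ℚᵘ.+-cong (ℚᵘ.≃-sym (toℚᵘ-/ i 0)) (ℚᵘ.≃-sym (toℚᵘ-/ j 0)))
  (ℚᵘ.≃-sym (ℚ.toℚᵘ-homo-+ (i / 1) (j / 1))))))

/1-* : ∀ i j → (i ℤ.* j) / 1 ≡ i / 1 ℚ.* (j / 1)
/1-* i j = ℚ.toℚᵘ-injective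
  (ℚᵘ.≃-trans (toℚᵘ-/ (i ℤ.* j) 0)
  (ℚᵘ.≃-trans (ℚᵘ.*-cong (ℚᵘ.≃-sym (toℚᵘ-/ i 0)) (ℚᵘ.≃-sym (toℚᵘ-/ j 0)))
  (ℚᵘ.≃-sym (ℚ.toℚᵘ-homo-* (i / 1) (j / 1)))))

/1-mono-≤ : ∀ {i j} → i ℤ.≤ j → i / 1 ℚ.≤ j / 1
/1-mono-≤ {i} {j} i≤j = ℚ.toℚᵘ-cancel-≤
  (ℚᵘ.≤-respˡ-≃ (ℚᵘ.≃-sym (toℚᵘ-/ i 0)) (ℚᵘ.≤-respʳ-≃ (ℚᵘ.≃-sym (toℚᵘ-/ j 0))
    (ℚᵘ.*≤* (ℤ.*-monoʳ-≤-nonNeg (+ 1) i≤j))))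

/1-cancel-≤ : ∀ {i j} → i / 1 ℚ.≤ j / 1 → i ℤ.≤ j
/1-cancel-≤ {i} {j} h = subst₂ ℤ._≤_ (ℤ.*-identityʳ i) (ℤ.*-identityʳ j)
  (ℚᵘ.drop-*≤* (ℚᵘ.≤-respˡ-≃ (toℚᵘ-/ i 0) (ℚᵘ.≤-respʳ-≃ (toℚᵘ-/ j 0) (ℚ.toℚᵘ-mono-≤ h))))

fromℤ-+ : ∀ i j → fromℤ (i ℤ.+ j) ≈ fromℤ i + fromℤ j
fromℤ-+ i j = ≈-pointwise {fromℤ (i ℤ.+ j)} {fromℤ i + fromℤ j} λ _ → /1-+ i j

fromℤ-* : ∀ i j → fromℤ (i ℤ.* j) ≈ fromℤ i * fromℤ j
fromℤ-* i j = ≈-pointwise {fromℤ (i ℤ.* j)} {fromℤ i * fromℤ j} λ _ → /1-* i j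

fromℤ-mono-≤ : ∀ {i j} → i ℤ.≤ j → fromℤ i ≤ fromℤ j
fromℤ-mono-≤ i≤j = fromℚ-mono-≤ (/1-mono-≤ i≤j)

fromℤ-cancel-≤ : ∀ {i j} → fromℤ i ≤ fromℤ j → i ℤ.≤ j
fromℤ-cancel-≤ h = /1-cancel-≤ (fromℚ-cancel-≤ h)

fromℤ-injective : ∀ {i j} → fromℤ i ≈ fromℤ j → i ≡ j
fromℤ-injective {i} {j} h = ℤ.≤-antisym
  (fromℤ-cancel-≤ (≤-reflexive {fromℤ i} {fromℤ j} h))
  (fromℤ-cancel-≤ (≤-reflexive {fromℤ j} {fromℤ i} (≈-sym {fromℤ i} {fromℤ j} h)))

floor : ∀ q → ∃[ k ] (k / 1 ℚ.≤ q × q ℚ.≤ (k ℤ.+ + 1) / 1)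
floor (mkℚ i d-1 c) = i ℤ./ℕ d , ℚ.toℚᵘ-cancel-≤ lower , ℚ.toℚᵘ-cancel-≤ upper
  where
  d = suc d-1
  lower : toℚᵘ ((i ℤ./ℕ d) / 1) ℚᵘ.≤ mkℚᵘ i d-1
  lower = ℚᵘ.≤-respˡ-≃ (ℚᵘ.≃-sym (toℚᵘ-/ (i ℤ./ℕ d) 0)) (ℚᵘ.*≤* (subst (i ℤ./ℕ d ℤ.* + d ℤ.≤_)
    (sym (ℤ.*-identityʳ i)) ([n/ℕd]*d≤n i d)))
  upper : mkℚᵘ i d-1 ℚᵘ.≤ toℚᵘ ((i ℤ./ℕ d ℤ.+ + 1) / 1)
  upper = ℚᵘ.≤-respʳ-≃ (ℚᵘ.≃-sym (toℚᵘ-/ (i ℤ./ℕ d ℤ.+ + 1) 0)) (ℚᵘ.*≤*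
    (subst₂ ℤ._≤_ (sym (ℤ.*-identityʳ i))
      (cong (ℤ._* + d) (ℤ.+-comm (+ 1) (i ℤ./ℕ d))) (ℤ.<⇒≤ (n<s[n/ℕd]*d i d))))

-- The floor of a rational approximation within 1, shifted down by 1.
approxFloor : ∀ x → ∃[ k ] (fromℤ k ≤ x × x ≤ fromℤ (k ℤ.+ + 3))
approxFloor x with cauchy x 1ℚ (ℚ.positive⁻¹ 1ℚ)
... | N , h with floor (seq x N)
... | k , k≤q , q≤k+1 = k ℤ.- + 1 ,
  (λ ε 0<ε → N , λ n N≤n → ≤⇒<+ε {q = seq x n} 0<ε (ℚ.≤-trans
      (subst (ℚ._≤ seq x N ℚ.- 1ℚ) (sym (/1-+ k (ℤ.- + 1))) (ℚ.+-monoˡ-≤ (ℚ.- 1ℚ) k≤q))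
    (ℚ.<⇒≤ (p<q+ε⇒p-q<ε {seq x N} {1ℚ} {seq x n} (subst (seq x N ℚ.<_) (ℚ.+-comm (seq x n) 1ℚ)
      (∣p-q∣<ε⇒p<q+ε {seq x N} {seq x n} (h N n ℕ.≤-refl N≤n))))))) ,
  (λ ε 0<ε → N , λ n N≤n → ≤⇒<+ε 0<ε (ℚ.≤-trans
    (ℚ.<⇒≤ (∣p-q∣<ε⇒p<q+ε {seq x n} {seq x N} (h n N N≤n ℕ.≤-refl)))
    (subst (seq x N ℚ.+ 1ℚ ℚ.≤_) (lem k) (ℚ.+-monoˡ-≤ 1ℚ q≤k+1))))
  where
  ≤⇒<+ε : ∀ {p q ε} → 0ℚ ℚ.< ε → p ℚ.≤ q → p ℚ.< q ℚ.+ ε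
  ≤⇒<+ε {p} {q} {ε} 0<ε p≤q = subst (ℚ._< q ℚ.+ ε) (ℚ.+-identityʳ p) (ℚ.+-mono-≤-< p≤q 0<ε)
  lem : ∀ k → (k ℤ.+ + 1) / 1 ℚ.+ 1ℚ ≡ ((k ℤ.- + 1) ℤ.+ + 3) / 1
  lem k = trans (sym (/1-+ (k ℤ.+ + 1) (+ 1))) (cong (_/ 1) (trans (ℤ.+-assoc k (+ 1) (+ 1)) (sym (ℤ.+-assoc k (ℤ.- + 1) (+ 3)))))

-- Logarithms

2^≤⇒≤⌊log₂⌋ : ∀ {a n} → 2 ℕ.^ a ℕ.≤ n → a ℕ.≤ ⌊log₂ n ⌋
2^≤⇒≤⌊log₂⌋ {a} h = subst (ℕ._≤ _) (⌊log₂[2^n]⌋≡n a) (⌊log₂⌋-mono-≤ h)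

-- Bernoulli's inequality (1 + 1/n)^k ≥ 1 + k/n with denominators cleared.
bernoulli : ∀ n k → (n ℕ.+ k) ℕ.* n ℕ.^ k ℕ.≤ n ℕ.* suc n ℕ.^ k
bernoulli n zero    = ℕ.≤-reflexive (cong (ℕ._* 1) (ℕ.+-identityʳ n))
bernoulli n (suc k) = begin
  (n ℕ.+ suc k) ℕ.* (n ℕ.* n ℕ.^ k)             ≤⟨ ℕ.m≤m+n _ (k ℕ.* n ℕ.^ k) ⟩
  (n ℕ.+ suc k) ℕ.* (n ℕ.* n ℕ.^ k) ℕ.+ k ℕ.* n ℕ.^ k  ≡⟨ lem n k (n ℕ.^ k) ⟩
  suc n ℕ.* ((n ℕ.+ k) ℕ.* n ℕ.^ k)             ≤⟨ ℕ.*-monoʳ-≤ (suc n) (bernoulli n k) ⟩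
  suc n ℕ.* (n ℕ.* suc n ℕ.^ k)                 ≡⟨ lem′ n (suc n ℕ.^ k) ⟩
  n ℕ.* (suc n ℕ.* suc n ℕ.^ k)                 ∎
  where
  open ℕ.≤-Reasoning
  lem : ∀ n k x → (n ℕ.+ (1 ℕ.+ k)) ℕ.* (n ℕ.* x) ℕ.+ k ℕ.* x ≡ (1 ℕ.+ n) ℕ.* ((n ℕ.+ k) ℕ.* x)
  lem = ℕ-solve-∀
  lem′ : ∀ n x → (1 ℕ.+ n) ℕ.* (n ℕ.* x) ≡ n ℕ.* ((1 ℕ.+ n) ℕ.* x)
  lem′ = ℕ-solve-∀

2n^n≤[1+n]^n : ∀ n .{{_ : ℕ.NonZero n}} → 2 ℕ.* n ℕ.^ n ℕ.≤ suc n ℕ.^ n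
2n^n≤[1+n]^n n = ℕ.*-cancelˡ-≤ n (ℕ.≤-trans (ℕ.≤-reflexive (lem n (n ℕ.^ n))) (bernoulli n n))
  where
  lem : ∀ n x → n ℕ.* (2 ℕ.* x) ≡ (n ℕ.+ n) ℕ.* x
  lem = ℕ-solve-∀

-- Of the m factors 1 + 1/n, every block of n contributes at least 2; the remaining m % n factors
-- are at least 1. This is the source of the strict gap.
2^[m/n]*n^m≤[1+n]^m : ∀ n m .{{_ : ℕ.NonZero n}} → 2 ℕ.^ (m ℕ./ n) ℕ.* n ℕ.^ m ℕ.≤ suc n ℕ.^ m
2^[m/n]*n^m≤[1+n]^m n m = begin
  2 ℕ.^ j ℕ.* n ℕ.^ m                             ≡⟨ cong (2 ℕ.^ j ℕ.*_) (power n) ⟩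
  2 ℕ.^ j ℕ.* (n ℕ.^ ρ ℕ.* (n ℕ.^ n) ℕ.^ j)        ≡⟨ lem (2 ℕ.^ j) (n ℕ.^ ρ) ((n ℕ.^ n) ℕ.^ j) ⟩
  n ℕ.^ ρ ℕ.* (2 ℕ.^ j ℕ.* (n ℕ.^ n) ℕ.^ j)        ≡⟨ cong (n ℕ.^ ρ ℕ.*_) (^-distribʳ-* 2 (n ℕ.^ n) j) ⟨
  n ℕ.^ ρ ℕ.* (2 ℕ.* n ℕ.^ n) ℕ.^ j                ≤⟨ ℕ.*-mono-≤ (ℕ.^-monoˡ-≤ ρ (ℕ.n≤1+n n)) (ℕ.^-monoˡ-≤ j (2n^n≤[1+n]^n n)) ⟩
  suc n ℕ.^ ρ ℕ.* (suc n ℕ.^ n) ℕ.^ j              ≡⟨ power (suc n) ⟨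
  suc n ℕ.^ m                                     ∎
  where
  open ℕ.≤-Reasoning
  j = m ℕ./ n
  ρ = m ℕ.% n
  power : ∀ x → x ℕ.^ m ≡ x ℕ.^ ρ ℕ.* (x ℕ.^ n) ℕ.^ j
  power x = trans (cong (x ℕ.^_) (trans (m≡m%n+[m/n]*n m n) (cong (ρ ℕ.+_) (ℕ.*-comm j n))))
    (trans (ℕ.^-distribˡ-+-* x ρ (n ℕ.* j)) (cong (x ℕ.^ ρ ℕ.*_) (sym (ℕ.^-*-assoc x n j))))
  lem : ∀ a b c → a ℕ.* (b ℕ.* c) ≡ b ℕ.* (a ℕ.* c)
  lem = ℕ-solve-∀

-- Logarithms of 2^(m/n) n^m ≤ (n + 1)^m ≤ a^m 2^(r m). Rounding down is harmless on the left and
-- costs 1 on the right.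
⌊log₂⌋-gap : ∀ n a r m .{{_ : ℕ.NonZero n}} → suc n ℕ.≤ a ℕ.* 2 ℕ.^ r →
  ⌊log₂ n ℕ.^ m ⌋ ℕ.+ m ℕ./ n ℕ.≤ suc ⌊log₂ a ℕ.^ m ⌋ ℕ.+ r ℕ.* m
⌊log₂⌋-gap n a r m h = 2^-cancel-≤ (begin
  2 ℕ.^ (⌊log₂ n ℕ.^ m ⌋ ℕ.+ m ℕ./ n)                ≡⟨ ℕ.^-distribˡ-+-* 2 ⌊log₂ n ℕ.^ m ⌋ (m ℕ./ n) ⟩
  2 ℕ.^ ⌊log₂ n ℕ.^ m ⌋ ℕ.* 2 ℕ.^ (m ℕ./ n)          ≤⟨ ℕ.*-monoˡ-≤ (2 ℕ.^ (m ℕ./ n)) (2^⌊log₂⌋≤ (n ℕ.^ m) {{ℕ.m^n≢0 n m}}) ⟩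
  n ℕ.^ m ℕ.* 2 ℕ.^ (m ℕ./ n)                        ≡⟨ ℕ.*-comm (n ℕ.^ m) _ ⟩
  2 ℕ.^ (m ℕ./ n) ℕ.* n ℕ.^ m                        ≤⟨ 2^[m/n]*n^m≤[1+n]^m n m ⟩
  suc n ℕ.^ m                                       ≤⟨ ℕ.^-monoˡ-≤ m h ⟩
  (a ℕ.* 2 ℕ.^ r) ℕ.^ m                              ≡⟨ ^-distribʳ-* a (2 ℕ.^ r) m ⟩
  a ℕ.^ m ℕ.* (2 ℕ.^ r) ℕ.^ m                        ≤⟨ ℕ.*-monoˡ-≤ ((2 ℕ.^ r) ℕ.^ m) (≤2^1+⌊log₂⌋ (a ℕ.^ m)) ⟩
  2 ℕ.^ suc ⌊log₂ a ℕ.^ m ⌋ ℕ.* (2 ℕ.^ r) ℕ.^ m      ≡⟨ cong (2 ℕ.^ suc ⌊log₂ a ℕ.^ m ⌋ ℕ.*_) (ℕ.^-*-assoc 2 r m) ⟩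
  2 ℕ.^ suc ⌊log₂ a ℕ.^ m ⌋ ℕ.* 2 ℕ.^ (r ℕ.* m)      ≡⟨ ℕ.^-distribˡ-+-* 2 (suc ⌊log₂ a ℕ.^ m ⌋) (r ℕ.* m) ⟨
  2 ℕ.^ (suc ⌊log₂ a ℕ.^ m ⌋ ℕ.+ r ℕ.* m)            ∎)
  where open ℕ.≤-Reasoning

-- After one unit of m / n has paid for the rounding, j + 1 units remain, and m < (j + 3) n ≤ 3 (j +
-- 1) n. Hence the constant 3n.
m≤3n[m/n∸1] : ∀ n m j .{{_ : ℕ.NonZero n}} → m ℕ./ n ≡ suc (suc j) → m ℕ.≤ 3 ℕ.* n ℕ.* suc j
m≤3n[m/n∸1] n m j eq = begin
  m                                  ≡⟨ m≡m%n+[m/n]*n m n ⟩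
  m ℕ.% n ℕ.+ m ℕ./ n ℕ.* n           ≤⟨ ℕ.+-monoˡ-≤ (m ℕ./ n ℕ.* n) (ℕ.<⇒≤ (m%n<n m n)) ⟩
  n ℕ.+ m ℕ./ n ℕ.* n                 ≡⟨ cong (λ i → n ℕ.+ i ℕ.* n) eq ⟩
  n ℕ.+ suc (suc j) ℕ.* n             ≤⟨ ℕ.m≤m+n _ (2 ℕ.* (j ℕ.* n)) ⟩
  n ℕ.+ suc (suc j) ℕ.* n ℕ.+ 2 ℕ.* (j ℕ.* n)   ≡⟨ lem n j ⟩
  3 ℕ.* n ℕ.* suc j                   ∎
  where
  open ℕ.≤-Reasoning
  lem : ∀ n j → n ℕ.+ (2 ℕ.+ j) ℕ.* n ℕ.+ 2 ℕ.* (j ℕ.* n) ≡ 3 ℕ.* n ℕ.* (1 ℕ.+ j)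
  lem = ℕ-solve-∀

scaled-gap : ∀ n a r m .{{_ : ℕ.NonZero n}} → suc n ℕ.≤ a ℕ.* 2 ℕ.^ r → 2 ℕ.* n ℕ.≤ m →
  ⌊log₂ n ℕ.^ m ⌋ ℕ.* (3 ℕ.* n) ℕ.+ m ℕ.≤ (⌊log₂ a ℕ.^ m ⌋ ℕ.+ r ℕ.* m) ℕ.* (3 ℕ.* n)
scaled-gap n a r m h 2n≤m with m ℕ./ n in eq | subst (ℕ._≤ m ℕ./ n) (m*n/n≡m 2 n) (/-monoˡ-≤ n 2n≤m) | ⌊log₂⌋-gap n a r m h
... | suc (suc j) | s≤s (s≤s _) | gap = begin
  T ℕ.* (3 ℕ.* n) ℕ.+ m                       ≤⟨ ℕ.+-monoʳ-≤ (T ℕ.* (3 ℕ.* n)) (m≤3n[m/n∸1] n m j eq) ⟩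
  T ℕ.* (3 ℕ.* n) ℕ.+ 3 ℕ.* n ℕ.* suc j        ≡⟨ lem T n j ⟩
  (T ℕ.+ suc j) ℕ.* (3 ℕ.* n)                 ≤⟨ ℕ.*-monoˡ-≤ (3 ℕ.* n) {T ℕ.+ suc j} {⌊log₂ a ℕ.^ m ⌋ ℕ.+ r ℕ.* m} (ℕ.≤-pred (subst (ℕ._≤ suc ⌊log₂ a ℕ.^ m ⌋ ℕ.+ r ℕ.* m) (ℕ.+-suc T (suc j)) gap)) ⟩
  (⌊log₂ a ℕ.^ m ⌋ ℕ.+ r ℕ.* m) ℕ.* (3 ℕ.* n)  ∎
  where
  open ℕ.≤-Reasoning
  T = ⌊log₂ n ℕ.^ m ⌋
  lem : ∀ T n j → T ℕ.* (3 ℕ.* n) ℕ.+ 3 ℕ.* n ℕ.* (1 ℕ.+ j) ≡ (T ℕ.+ (1 ℕ.+ j)) ℕ.* (3 ℕ.* n)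
  lem = ℕ-solve-∀

fraction-gap : ∀ T A r k c → T ℕ.* suc c ℕ.+ suc k ℕ.≤ (A ℕ.+ r ℕ.* suc k) ℕ.* suc c →
  + T / suc k ℚ.+ + 1 / suc c ℚ.≤ + A / suc k ℚ.+ + r / 1
fraction-gap T A r k c h = ℚ.toℚᵘ-cancel-≤ (begin
  toℚᵘ (+ T / suc k ℚ.+ + 1 / suc c)          ≃⟨ ℚ.toℚᵘ-homo-+ (+ T / suc k) (+ 1 / suc c) ⟩
  toℚᵘ (+ T / suc k) ℚᵘ.+ toℚᵘ (+ 1 / suc c)  ≃⟨ ℚᵘ.+-cong (toℚᵘ-/ (+ T) k) (toℚᵘ-/ (+ 1) c) ⟩
  mkℚᵘ (+ T) k ℚᵘ.+ mkℚᵘ (+ 1) c              ≤⟨ ℚᵘ.*≤* goal ⟩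
  mkℚᵘ (+ A) k ℚᵘ.+ mkℚᵘ (+ r) 0              ≃⟨ ℚᵘ.+-cong (ℚᵘ.≃-sym (toℚᵘ-/ (+ A) k)) (ℚᵘ.≃-sym (toℚᵘ-/ (+ r) 0)) ⟩
  toℚᵘ (+ A / suc k) ℚᵘ.+ toℚᵘ (+ r / 1)      ≃⟨ ℚᵘ.≃-sym (ℚ.toℚᵘ-homo-+ (+ A / suc k) (+ r / 1)) ⟩
  toℚᵘ (+ A / suc k ℚ.+ + r / 1)              ∎)
  where
  open ℚᵘ.≤-Reasoning
  m C : ℕ
  m = suc k
  C = suc c
  nat : (T ℕ.* C ℕ.+ 1 ℕ.* m) ℕ.* (m ℕ.* 1) ℕ.≤ (A ℕ.* 1 ℕ.+ r ℕ.* m) ℕ.* (m ℕ.* C)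
  nat = subst₂ ℕ._≤_ (lem₁ (T ℕ.* C) m) (lem₂ A (r ℕ.* m) C m) (ℕ.*-monoˡ-≤ m h)
    where
    lem₁ : ∀ x m → (x ℕ.+ m) ℕ.* m ≡ (x ℕ.+ 1 ℕ.* m) ℕ.* (m ℕ.* 1)
    lem₁ = ℕ-solve-∀
    lem₂ : ∀ A x C m → (A ℕ.+ x) ℕ.* C ℕ.* m ≡ (A ℕ.* 1 ℕ.+ x) ℕ.* (m ℕ.* C)
    lem₂ = ℕ-solve-∀
  cast : ∀ x y z w D → (+ x ℤ.* + y ℤ.+ + z ℤ.* + w) ℤ.* + D ≡ + ((x ℕ.* y ℕ.+ z ℕ.* w) ℕ.* D)
  cast x y z w D = trans
    (cong (ℤ._* + D) (cong₂ ℤ._+_ (sym (ℤ.pos-* x y)) (sym (ℤ.pos-* z w))))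
    (sym (ℤ.pos-* (x ℕ.* y ℕ.+ z ℕ.* w) D))
  goal : (+ T ℤ.* + C ℤ.+ + 1 ℤ.* + m) ℤ.* + (m ℕ.* 1) ℤ.≤ (+ A ℤ.* + 1 ℤ.+ + r ℤ.* + m) ℤ.* + (m ℕ.* C)
  goal = subst₂ ℤ._≤_ (sym (cast T C 1 m (m ℕ.* 1))) (sym (cast A 1 r m (m ℕ.* C))) (ℤ.+≤+ nat)

/-mono-≤ : ∀ k {i j} → i ℤ.≤ j → i / suc k ℚ.≤ j / suc k
/-mono-≤ k {i} {j} h = ℚ.toℚᵘ-cancel-≤ (ℚᵘ.≤-respˡ-≃ (ℚᵘ.≃-sym (toℚᵘ-/ i k))
  (ℚᵘ.≤-respʳ-≃ (ℚᵘ.≃-sym (toℚᵘ-/ j k)) (ℚᵘ.*≤* (ℤ.*-monoʳ-≤-nonNeg (+ suc k) h))))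

log₂-approx-ℕ : ∀ k n → log₂-approx k (+ n / 1) ≡ + ⌊log₂ n ℕ.^ suc k ⌋ / suc k
log₂-approx-ℕ k n = trans (cong (log₂-approx k) (ℚ.normalize-coprime (Coprime.sym (Coprime.1-coprimeTo n))))
  (cong (_/ suc k) (trans
    (cong (λ l → + ⌊log₂ n ℕ.^ suc k ⌋ ℤ.- + ⌊log₂ l ⌋) (ℕ.^-zeroˡ (suc k)))
    (ℤ.+-identityʳ (+ ⌊log₂ n ℕ.^ suc k ⌋))))

-- In lowest terms t / m is some p / q with a q ≤ p, where m = k + 1. From 2^(⌊log₂ a^m⌋ + ⌊log₂
-- q^m⌋) ≤ a^m q^m ≤ p^m the estimate follows without any rounding loss.
log₂-approx-lower : ∀ k a t .{{_ : ℕ.NonZero a}} → a ℕ.* suc k ℕ.≤ t →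
  + ⌊log₂ a ℕ.^ suc k ⌋ / suc k ℚ.≤ log₂-approx k (+ t / suc k)
log₂-approx-lower k a t h = go (+ t / suc k) a≤s
  where
  m = suc k
  a≤s : mkℚᵘ (+ a) 0 ℚᵘ.≤ toℚᵘ (+ t / suc k)
  a≤s = ℚᵘ.≤-respʳ-≃ (ℚᵘ.≃-sym (toℚᵘ-/ (+ t) k)) (ℚᵘ.*≤*
    (subst₂ ℤ._≤_ (ℤ.pos-* a m) (sym (ℤ.*-identityʳ (+ t))) (ℤ.+≤+ h)))
  go : ∀ s → mkℚᵘ (+ a) 0 ℚᵘ.≤ toℚᵘ s → + ⌊log₂ a ℕ.^ m ⌋ / m ℚ.≤ log₂-approx k s
  go (mkℚ (+ p) q-1 _) (ℚᵘ.*≤* le) = /-mono-≤ k (subst (ℤ._≤ + ⌊log₂ p ℕ.^ m ⌋ ℤ.- + ⌊log₂ q ℕ.^ m ⌋)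
      (lem (+ ⌊log₂ a ℕ.^ m ⌋) (+ ⌊log₂ q ℕ.^ m ⌋))
      (ℤ.+-monoˡ-≤ (ℤ.- + ⌊log₂ q ℕ.^ m ⌋) (ℤ.+≤+ (2^≤⇒≤⌊log₂⌋ (begin
        2 ℕ.^ (⌊log₂ a ℕ.^ m ⌋ ℕ.+ ⌊log₂ q ℕ.^ m ⌋)           ≡⟨ ℕ.^-distribˡ-+-* 2 ⌊log₂ a ℕ.^ m ⌋ ⌊log₂ q ℕ.^ m ⌋ ⟩
        2 ℕ.^ ⌊log₂ a ℕ.^ m ⌋ ℕ.* 2 ℕ.^ ⌊log₂ q ℕ.^ m ⌋       ≤⟨ ℕ.*-mono-≤ (2^⌊log₂⌋≤ (a ℕ.^ m) {{ℕ.m^n≢0 a m}}) (2^⌊log₂⌋≤ (q ℕ.^ m) {{ℕ.m^n≢0 q m}}) ⟩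
        a ℕ.^ m ℕ.* q ℕ.^ m                                  ≡⟨ ^-distribʳ-* a q m ⟨
        (a ℕ.* q) ℕ.^ m                                      ≤⟨ ℕ.^-monoˡ-≤ m aq≤p ⟩
        p ℕ.^ m                                              ∎)))))
    where
    open ℕ.≤-Reasoning
    q = suc q-1
    lem : ∀ x y → x ℤ.+ y ℤ.- y ≡ x
    lem = ℤ-solve-∀
    aq≤p : a ℕ.* q ℕ.≤ p
    aq≤p = ℤ.drop‿+≤+ (subst₂ ℤ._≤_ (sym (ℤ.pos-* a q)) (ℤ.*-identityʳ (+ p)) le)
  go (mkℚ (ℤ.-[1+ p ]) q-1 _) (ℚᵘ.*≤* le) = contradiction
    (ℤ.≤-trans (ℤ.≤-reflexive (ℤ.pos-* a (suc q-1))) le) λ ()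

-- The base must not exceed log₂ n, to be comparable with log₂ log₂ n. If r + 1 is too large, then n
-- < 2^(r + 1), so base 2 satisfies the second bound, and 2 ≤ log₂ n amounts to 4 ≤ n. The witness
-- is the base minus one.
base-choice : ∀ n r → 4 ℕ.≤ n → suc n ℕ.≤ suc r ℕ.* 2 ℕ.^ r →
  ∃[ a ] (2 ℕ.^ suc a ℕ.≤ n × suc n ℕ.≤ suc a ℕ.* 2 ℕ.^ r)
base-choice n r 4≤n h with 2 ℕ.^ suc r ℕ.≤? n
... | yes p = r , p , h
... | no ¬p = 1 , 4≤n , ℕ.≰⇒> ¬p

-- Comparison is term by term. With m = k + 1, the inner approximation ⌊log₂ n^m⌋ / m is also the
-- argument of the outer one, and ⌊log₂ a^m⌋ / m links the two estimates: it bounds the outer term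
-- from below and, with r added, the inner term plus 1 / (3n) from above. The index 2n ensures m / n
-- ≥ 2.
log₂-bound : ∀ n r (4≤n : 4 ℕ.≤ n) → suc n ℕ.≤ suc r ℕ.* 2 ℕ.^ r →
  log₂ (fromℕ n) (0<fromℕ 4≤n) - log₂ (log₂ (fromℕ n) (0<fromℕ 4≤n)) (0<log₂ 4≤n) < fromℕ r
log₂-bound n@(suc n-1) r 4≤n h = + 1 / (3 ℕ.* n) ,
  ℚ.positive⁻¹ (+ 1 / (3 ℕ.* n)) {{ℚ.normalize-pos 1 (3 ℕ.* n)}} , 2 ℕ.* n , λ k 2n≤k → begin
    (log₂-approx k s ℚ.- log₂-approx k (log₂-approx k s)) ℚ.+ ε
      ≡⟨ swap (log₂-approx k s) (log₂-approx k (log₂-approx k s)) ε ⟩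
    (log₂-approx k s ℚ.+ ε) ℚ.- log₂-approx k (log₂-approx k s)
      ≤⟨ ℚ.+-monoˡ-≤ (ℚ.- log₂-approx k (log₂-approx k s)) (upper k 2n≤k) ⟩
    (log₂-approx k (log₂-approx k s) ℚ.+ + r / 1) ℚ.- log₂-approx k (log₂-approx k s)
      ≡⟨ cancel (log₂-approx k (log₂-approx k s)) (+ r / 1) ⟩
    + r / 1 ∎
  where
  open ℚ.≤-Reasoning
  s ε : ℚ
  s = + n / 1
  ε = + 1 / (3 ℕ.* n)
  a : ℕ
  a = suc (proj₁ (base-choice n r 4≤n h))
  open +-*-Solver
  swap : ∀ x y e → (x ℚ.- y) ℚ.+ e ≡ (x ℚ.+ e) ℚ.- y
  swap = solve 3 (λ x y e → (x :- y) :+ e := (x :+ e) :- y) refl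
  cancel : ∀ y r → (y ℚ.+ r) ℚ.- y ≡ r
  cancel = solve 2 (λ y r → (y :+ r) :- y := r) refl
  am≤T : ∀ k → a ℕ.* suc k ℕ.≤ ⌊log₂ n ℕ.^ suc k ⌋
  am≤T k = 2^≤⇒≤⌊log₂⌋ (ℕ.≤-trans (ℕ.≤-reflexive (sym (ℕ.^-*-assoc 2 a (suc k))))
    (ℕ.^-monoˡ-≤ (suc k) (proj₁ (proj₂ (base-choice n r 4≤n h)))))
  upper : ∀ k → 2 ℕ.* n ℕ.≤ k → log₂-approx k s ℚ.+ ε ℚ.≤ log₂-approx k (log₂-approx k s) ℚ.+ + r / 1
  upper k 2n≤k = subst (λ x → x ℚ.+ ε ℚ.≤ log₂-approx k x ℚ.+ + r / 1) (sym (log₂-approx-ℕ k n))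
    (ℚ.≤-trans
      (fraction-gap ⌊log₂ n ℕ.^ suc k ⌋ ⌊log₂ a ℕ.^ suc k ⌋ r k _
        (scaled-gap n a r (suc k) (proj₂ (proj₂ (base-choice n r 4≤n h))) (ℕ.m≤n⇒m≤1+n 2n≤k)))
      (ℚ.+-monoˡ-≤ (+ r / 1) (log₂-approx-lower k a ⌊log₂ n ℕ.^ suc k ⌋ (am≤T k))))

-- The reals as an Archimedean domain

fromℤ-inverse : ∀ i → ¬ i ≡ + 0 → ∃[ y ] y * fromℤ i ≈ 1ℝ
fromℤ-inverse i i≢0 = fromℚ (ℚ.1/ (i / 1)) ,
  ≈-pointwise {fromℚ (ℚ.1/ (i / 1)) * fromℤ i} {1ℝ} λ _ → ℚ.*-inverseˡ (i / 1)
  where instance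
    i/1≢0 : ℚ.NonZero (i / 1)
    i/1≢0 = ℚ.≢-nonZero λ eq → i≢0 (fromℤ-injective {i} {+ 0} (fromℚ-cong {i / 1} {0ℚ} eq))

<⇒slack : ∀ {x y} → x < y → ∃[ κ ] ∀ v → κ * v ≤ fromℤ (+ 3) → x + v ≤ y
<⇒slack {x} {y} x<y =
  let ε , 0<ε , x+ε≤y = <⇒gap {x} {y} x<y
      κ , 0<κ , εκ≡3 = quotient {+ 3 / 1} {ε} (ℚ.positive⁻¹ (+ 3 / 1)) 0<ε
  in fromℚ κ , λ v κv≤3 → ≤-trans {x + v} {x + fromℚ ε} {y}
       (+-mono-≤ {x} {x} {v} {fromℚ ε} (≤-reflexive {x} {x} (≈-refl {x}))
         (fromℚ-cancelˡ-≤ {κ} {v} {fromℚ ε} 0<κ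
           (≤-trans {fromℚ κ * v} {fromℤ (+ 3)} {fromℚ κ * fromℚ ε} κv≤3
             (≤-reflexive {fromℤ (+ 3)} {fromℚ κ * fromℚ ε}
               (fromℚ-cong (trans (sym εκ≡3) (ℚ.*-comm ε κ)))))))
       x+ε≤y

ℝ-archimedeanDomain : ArchimedeanDomain
ℝ-archimedeanDomain = record
  { commutativeRing = ℝ-commutativeRing
  ; 1≉0             = λ 1≈0 → contradiction (fromℤ-injective {+ 1} {+ 0} 1≈0) λ ()
  ; ≈0-stable       = ≈0-stable
  ; noZeroDivisors  = ℝ-noZeroDivisors
  ; _≤_             = _≤_
  ; ≤-reflexive     = λ {x} {y} → ≤-reflexive {x} {y}
  ; ≤-trans         = λ {x} {y} {z} → ≤-trans {x} {y} {z}
  ; +-mono-≤        = λ {x} {y} {u} {v} → +-mono-≤ {x} {y} {u} {v}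
  ; ι               = fromℤ
  ; ι-+             = fromℤ-+
  ; ι-*             = fromℤ-*
  ; ι-1             = ≈-refl {1ℝ}
  ; ι-mono-≤        = fromℤ-mono-≤
  ; ι-cancel-≤      = fromℤ-cancel-≤
  ; ι-inverse       = fromℤ-inverse
  ; approxFloor     = approxFloor
  ; ¬¬-slack        = λ {x} {y} x≤y x≉y ¬slack →
      ≤∧≉⇒¬¬< {x} {y} x≤y x≉y λ x<y → ¬slack (<⇒slack {x} {y} x<y)
  }

-- The bound on the relaxation complexity

range⊆aff : ∀ {d m} (p : Fin m → ℝ^ d) j → p j ∈ aff (range p)
range⊆aff p j = 1 , (λ _ → 1ℝ) , (λ _ → p j) , (λ _ → j , λ l → ≈-refl {p j l}) ,
  R.+-identityʳ 1ℝ , λ l → R.trans {1ℝ * p j l + 0ℝ} {1ℝ * p j l} {p j l}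
    (R.+-identityʳ (1ℝ * p j l)) (R.*-identityˡ (p j l))
  where module R = CommutativeRing ℝ-commutativeRing

described⇒dimension-bound : ∀ {d r n} {X : Pred (ℤ^ d) 0ℓ} → Finite X → DescribedBy X r →
  (p : Fin n → ℝ^ d) → AffinelyIndependent p → (∀ j → p j ∈ aff (image X)) →
  n ℕ.≤ ℕ.suc r ℕ.* 2 ℕ.^ r
described⇒dimension-bound {X = X} (xs , X⊆xs , xs⊆X) (A , b , m , U , v , sound , complete) p independent p∈aff =
  Covering.embedded-dimension-bound ℝ-archimedeanDomain embed (λ x l → ≈-refl {embed x l})
    X xs (λ _ x∈X → X⊆xs x∈X) (λ _ x∈xs → xs⊆X x∈xs)
    A b U v (λ x x∈X → sound {x} x∈X) (λ x hA hU → complete {x} (hA , hU)) p independent p∈aff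

theorem1p2 :
    ∀ {d} (X : Pred (ℤ^ d) 0ℓ) → Finite X → LatticeConvex X →
    ∀ n → Dimension X n → (4≤n : 4 ℕ.≤ n) →
    ∀ r → RelaxationComplexity X r →
    log₂ (fromℕ n) (0<fromℕ 4≤n) - log₂ (log₂ (fromℕ n) (0<fromℕ 4≤n)) (0<log₂ 4≤n) < fromℕ r
theorem1p2 X finite _ n (p , independent , _ , aff⊆) 4≤n r (described , _) =
  log₂-bound n r 4≤n (described⇒dimension-bound {X = X} finite described p independent λ j → aff⊆ {p j} (range⊆aff p j))
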